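{- Let $T$ be a finite tree. If $T$ has a $(\gamma_t-\tau)$-set, then $T\in\mathcal{T}$, where $\mathcal{T}$ is the family of trees constructed from the path $P_4$ by the operations $\mathcal{O}_1,\mathcal{O}_2,\mathcal{O}_3,\mathcal{O}_4$ defined in the context.
   Context: All graphs are finite, undirected, simple and connected. $N(v)$ is the set of neighbors of $v$ (so $v\notin N(v)$). $P_n$ is the path with $n$ vertices. An end vertex (leaf) is a vertex of degree 1; a support vertex is a neighbor of an end vertex. A vertex cover of $G=(V,E)$ is a set $X\subseteq V$ such that each edge is incident to at least one vertex of $X$; $\tau(G)$ is the minimum cardinality of a vertex cover, and a $\tau(G)$-set is a vertex cover of cardinality $\tau(G)$. A total dominating set of $G$ is a dominating set $D\subseteq V$ such that the subgraph induced by $D$ has no isolated vertices (equivalently, every vertex of $G$ has a neighbor in $D$); $\gamma_t(G)$ is the minimum cardinality of a total dominating set (defined for graphs without isolated vertices), and a $\gamma_t(G)$-set is a total dominating set of cardinality $\gamma_t(G)$. A $(\gamma_t-\tau)$-set of $G$ is a set that is both a $\gamma_t(G)$-set and a $\tau(G)$-set. For $S\subseteq V$ and $v\in S$, $\mathrm{pn}(v,S)=\{u\in V : N(u)\cap S=\{v\}\}$. For a $\gamma_t(G)$-set $S$, a vertex $v$ is $S$-quasi-isolated if there is $u\in S$ with $\mathrm{pn}(u,S)=\{v\}$; $v$ is quasi-isolated (in $G$) if it is $S$-quasi-isolated for some $\gamma_t(G)$-set $S$. For disjoint graphs $G,H$ with $u\in V(G)$, $v\in V(H)$, the sum of $G$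 with $H$ via the edge $uv$, $G+_{uv}H$, has vertex set $V(G)\cup V(H)$ and edge set $E(G)\cup E(H)\cup\{uv\}$. Operations on a tree $T$: - $\mathcal{O}_1$: choose $u\in V(T)$ belonging to some $(\gamma_t-\tau)$-set of $T$; let $v$ be a leaf of a (disjoint) path $P_4$; form $T+_{uv}P_4$. - $\mathcal{O}_2$: choose $u\in V(T)$ belonging to some $(\gamma_t-\tau)$-set of $T$; add a new vertex $v$ adjacent exactly to $u$. - $\mathcal{O}_3$: choose $u\in V(T)$ belonging to some $(\gamma_t-\tau)$-set of $T$ and such that $u$ is not quasi-isolated in $T$; let $P_2=(v,w)$ be a (disjoint) path with two vertices; form $T+_{uv}P_2$. - $\mathcal{O}_4$: choose $u\in V(T)$ that is not quasi-isolated in $T$; let $v$ be a support vertex of a (disjoint) path $P_4$; form $T+_{uv}P_4$. The family $\mathcal{T}$ consists of all trees $T$ (up to isomorphism) for which there is a sequence $T_1,\dots,T_k$ ($k\ge 1$) of trees such that $T_1=P_4$, $T_k=T$, and, if $k\ge 2$, each $T_{i+1}$ is obtained from $T_i$ by one of the operations $\mathcal{O}_1,\mathcal{O}_2,\mathcal{O}_3,\mathcal{O}_4$. -}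

module Defs where

open import Data.Nat.Base using (ℕ; suc; _+_; _≤_; NonZero)
open import Data.Nat.Properties using (1+n≢n)
import Data.Nat.Properties as ℕ
open import Data.Fin.Base using (Fin; zero; toℕ; splitAt)
import Data.Fin.Properties as Fin
open import Data.Fin.Subset using (Subset; _∈_; _∉_; ∣_∣; _∩_; ⁅_⁆)
open import Data.List.Base using (List; _∷_; _∷ʳ_; length)
open import Data.List.Relation.Unary.Linked using (Linked)
open import Data.List.Relation.Unary.Unique.Propositional using (Unique)
open import Data.Product.Base using (∃; ∃-syntax; _×_; _,_)
open import Data.Sum.Base using (_⊎_; inj₁; inj₂; swap)
open import Data.Vec.Base using (tabulate)
open import Function.Bundles using (_↔_; _⇔_; Inverse)
open import Level using (0ℓ)
open import Relation.Binary.Construct.Closure.ReflexiveTransitive using (Star)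
open import Relation.Binary.Core using (Rel)
open import Relation.Binary.Definitions using (Decidable; Symmetric; Irreflexive)
open import Relation.Binary.PropositionalEquality.Core using (_≡_; refl; sym)
open import Relation.Nullary using (¬_; yes; no; does)
open import Relation.Nullary.Decidable using (_⊎-dec_; _×-dec_; map′)
open import Relation.Unary using (Pred; _≐_; ｛_｝)

------------------------------------------------------------------------
-- Finite simple graphs

record Graph (n : ℕ) : Set₁ where
  infix 4 _~_ _~?_
  field
    _~_      : Rel (Fin n) 0ℓ
    _~?_     : Decidable _~_
    ~-sym    : Symmetric _~_
    ~-irrefl : Irreflexive _≡_ _~_

  N : Fin n → Subset n
  N v = tabulate (λ u → does (v ~? u))

  degree : Fin n → ℕ
  degree v = ∣ N v ∣

  IsLeaf : Pred (Fin n) 0ℓ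
  IsLeaf v = degree v ≡ 1

  IsSupport : Pred (Fin n) 0ℓ
  IsSupport v = ∃[ w ] (IsLeaf w × v ~ w)

  Connected : Set
  Connected = ∀ u v → Star _~_ u v

  -- The list v ∷ vs is a cycle, traversed once starting at v.
  IsCycle : Fin n → List (Fin n) → Set
  IsCycle v vs =
    3 ≤ length (v ∷ vs) × Unique (v ∷ vs) × Linked _~_ ((v ∷ vs) ∷ʳ v)

  Acyclic : Set
  Acyclic = ∀ v vs → ¬ IsCycle v vs

  -- Connected alone would admit the graph with no vertices.
  record IsTree : Set where
    field
      nonEmpty  : NonZero n
      connected : Connected
      acyclic   : Acyclic

------------------------------------------------------------------------
-- Vertex covers and total dominating sets

-- k is the minimum cardinality of the sets satisfying P.  This is a relation
-- because P may be unsatisfiable, as for total domination when there are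
-- isolated vertices.
IsMinCard : ∀ {n} → Pred (Subset n) 0ℓ → ℕ → Set
IsMinCard P k = (∃[ X ] (P X × ∣ X ∣ ≡ k)) × (∀ X → P X → k ≤ ∣ X ∣)

module _ {n : ℕ} (G : Graph n) where
  open Graph G

  IsVertexCover : Pred (Subset n) 0ℓ
  IsVertexCover X = ∀ u v → u ~ v → u ∈ X ⊎ v ∈ X

  IsDominating : Pred (Subset n) 0ℓ
  IsDominating D = ∀ v → v ∉ D → ∃[ u ] (u ∈ D × v ~ u)

  NoIsolatedIn : Pred (Subset n) 0ℓ
  NoIsolatedIn D = ∀ v → v ∈ D → ∃[ u ] (u ∈ D × v ~ u)

  IsTotalDominating : Pred (Subset n) 0ℓ
  IsTotalDominating D = IsDominating D × NoIsolatedIn D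

  IsVertexCoverNumber : Pred ℕ 0ℓ
  IsVertexCoverNumber = IsMinCard IsVertexCover

  IsTotalDominationNumber : Pred ℕ 0ℓ
  IsTotalDominationNumber = IsMinCard IsTotalDominating

  τ-Set : Pred (Subset n) 0ℓ
  τ-Set X = IsVertexCover X × IsVertexCoverNumber ∣ X ∣

  γₜ-Set : Pred (Subset n) 0ℓ
  γₜ-Set D = IsTotalDominating D × IsTotalDominationNumber ∣ D ∣

  γₜ-τ-Set : Pred (Subset n) 0ℓ
  γₜ-τ-Set S = γₜ-Set S × τ-Set S

  InSomeγₜ-τ-Set : Pred (Fin n) 0ℓ
  InSomeγₜ-τ-Set v = ∃[ S ] (γₜ-τ-Set S × v ∈ S)

  pn : Fin n → Subset n → Pred (Fin n) 0ℓ
  pn v S u = N u ∩ S ≡ ⁅ v ⁆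

  QuasiIsolatedWrt : Subset n → Pred (Fin n) 0ℓ
  QuasiIsolatedWrt S v = ∃[ u ] (u ∈ S × pn u S ≐ ｛ v ｝)

  QuasiIsolated : Pred (Fin n) 0ℓ
  QuasiIsolated v = ∃[ S ] (γₜ-Set S × QuasiIsolatedWrt S v)

------------------------------------------------------------------------
-- Isomorphisms, paths and sums

infix 4 _≅_

record _≅_ {m n : ℕ} (G : Graph m) (H : Graph n) : Set where
  private
    module G = Graph G
    module H = Graph H
  field
    bijection : Fin m ↔ Fin n
  open Inverse bijection public using (to; from)
  field
    preserves : ∀ u v → u G.~ v ⇔ to u H.~ to v

-- P n has vertices 0, 1, …, n - 1 in the order along the path.
P : ∀ n → Graph n
P n = record
  { _~_      = λ u v → suc (toℕ u) ≡ toℕ v ⊎ suc (toℕ v) ≡ toℕ u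
  ; _~?_     = λ u v → (suc (toℕ u) ℕ.≟ toℕ v) ⊎-dec (suc (toℕ v) ℕ.≟ toℕ u)
  ; ~-sym    = swap
  ; ~-irrefl = λ where
      refl (inj₁ e) → 1+n≢n e
      refl (inj₂ e) → 1+n≢n e
  }

module _ {m k : ℕ} (G : Graph m) (H : Graph k) (u : Fin m) (v : Fin k) where
  private
    module G = Graph G
    module H = Graph H

  data SumAdj : Rel (Fin m ⊎ Fin k) 0ℓ where
    left    : ∀ {x y} → x G.~ y → SumAdj (inj₁ x) (inj₁ y)
    right   : ∀ {x y} → x H.~ y → SumAdj (inj₂ x) (inj₂ y)
    bridge  : SumAdj (inj₁ u) (inj₂ v)
    bridge⁻ : SumAdj (inj₂ v) (inj₁ u)

  SumAdj-sym : Symmetric SumAdj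
  SumAdj-sym (left e)  = left (G.~-sym e)
  SumAdj-sym (right e) = right (H.~-sym e)
  SumAdj-sym bridge    = bridge⁻
  SumAdj-sym bridge⁻   = bridge

  SumAdj-irrefl : Irreflexive _≡_ SumAdj
  SumAdj-irrefl refl (left e)  = G.~-irrefl refl e
  SumAdj-irrefl refl (right e) = H.~-irrefl refl e

  SumAdj? : Decidable SumAdj
  SumAdj? (inj₁ x) (inj₁ y) = map′ left (λ { (left e) → e }) (x G.~? y)
  SumAdj? (inj₂ x) (inj₂ y) = map′ right (λ { (right e) → e }) (x H.~? y)
  SumAdj? (inj₁ x) (inj₂ y) =
    map′ (λ { (refl , refl) → bridge }) (λ { bridge → refl , refl })
         ((x Fin.≟ u) ×-dec (y Fin.≟ v))
  SumAdj? (inj₂ x) (inj₁ y) =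
    map′ (λ { (refl , refl) → bridge⁻ }) (λ { bridge⁻ → refl , refl })
         ((x Fin.≟ v) ×-dec (y Fin.≟ u))

  sumVia : Graph (m + k)
  sumVia = record
    { _~_      = λ x y → SumAdj (splitAt m x) (splitAt m y)
    ; _~?_     = λ x y → SumAdj? (splitAt m x) (splitAt m y)
    ; ~-sym    = SumAdj-sym
    ; ~-irrefl = λ { refl → SumAdj-irrefl refl }
    }

infixl 6 _+⟨_,_⟩_

_+⟨_,_⟩_ : ∀ {m k} → Graph m → Fin m → Fin k → Graph k → Graph (m + k)
G +⟨ u , v ⟩ H = sumVia G H u v

------------------------------------------------------------------------
-- The operations and the family

infix 4 _⟶_

data _⟶_ {m : ℕ} (T : Graph m) : ∀ {n} → Graph n → Set₁ where

  O₁ : (u : Fin m) (v : Fin 4) →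
       InSomeγₜ-τ-Set T u →
       Graph.IsLeaf (P 4) v →
       T ⟶ T +⟨ u , v ⟩ P 4

  O₂ : (u : Fin m) →
       InSomeγₜ-τ-Set T u →
       T ⟶ T +⟨ u , zero ⟩ P 1

  O₃ : (u : Fin m) →
       InSomeγₜ-τ-Set T u →
       ¬ QuasiIsolated T u →
       T ⟶ T +⟨ u , zero ⟩ P 2

  O₄ : (u : Fin m) (v : Fin 4) →
       ¬ QuasiIsolated T u →
       Graph.IsSupport (P 4) v →
       T ⟶ T +⟨ u , v ⟩ P 4

-- Every member is a tree, because the sum of two trees via an edge is a tree.
data 𝒯 : ∀ {n} → Graph n → Set₁ where
  base : 𝒯 (P 4)
  step : ∀ {m n} {T : Graph m} {T′ : Graph n} → 𝒯 T → T ⟶ T′ → 𝒯 T′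
  iso  : ∀ {m n} {T : Graph m} {T′ : Graph n} → 𝒯 T → T ≅ T′ → 𝒯 T′

{-# OPTIONS --safe #-}
-- Let S be a set that is both a γₜ-set and a τ-set.  By minimality each vertex
-- of S has a neighbour outside S, and a neighbour in S, so that leaves lie
-- outside S and supports inside.  In a branch of height three, rooted at p and
-- of parent q, a deepest path runs p, c, d, e with c, d ∈ S and e a leaf.
-- Unless p ∉ S and the branch at c is just the path c, d, e, some leaf, pendant
-- edge or pendant P₄ (attached by a support) can be removed, undoing O₂, O₃ or
-- O₄.  If two children c, c′ of p carry such bare paths, then exchanging c and
-- c′ for p in S gives a smaller cover; hence p, c, d, e is a pendant path, which
-- is the whole tree or is removed by undoing O₁.  In each case S restricts to
-- a (γₜ-τ)-set of the smaller tree.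
module Submission where

open import Defs
open import Algebra.Properties.CommutativeMonoid.Sum
  using (sum; sum-cong-≗; sum-permute)
open import Data.Bool.Base using (if_then_else_)
open import Data.Fin.Base using (Fin; zero; suc; toℕ; splitAt; join)
import Data.Fin.Properties as Fin
open import Data.Fin.Permutation using (↔⇒≡)
open import Data.Fin.Subset using (Subset; inside; outside; _∈_; _∉_; ∣_∣; _∩_; _∪_; _-_; ⁅_⁆)
open import Data.Fin.Subset.Properties
open import Data.List.Base as List using (List; []; _∷_; _∷ʳ_; length; allFin; filter)
import Data.List.Membership.Propositional.Properties as ∈ᴸ
open import Data.List.Membership.Propositional renaming (_∈_ to _∈ᴸ_) using ()
open import Data.List.Relation.Unary.Any as Any using (here; there)
open import Data.List.Relation.Unary.Any.Properties using (lookup-index)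
open import Data.List.Relation.Unary.Linked using (Linked; []; [-]; _∷_)
open import Data.List.Relation.Binary.Subset.Propositional.Properties using (∷⁺ʳ)
open import Data.List.Relation.Binary.Subset.Propositional renaming (_⊆_ to _⊆ᴸ_) using ()
open import Data.List.Relation.Unary.Unique.Propositional.Properties using (allFin⁺; filter⁺)
open import Data.List.Relation.Unary.AllPairs as AllPairs using ([]; _∷_)
open import Data.List.Relation.Unary.All as All using (All; []; _∷_)
open import Data.List.Relation.Unary.Unique.Propositional using (Unique)
open import Data.Nat.Base as ℕ using (ℕ; zero; suc; _+_; _≤_; _<_; s≤s; z≤n)
open import Data.Nat.Induction using (Acc; acc; <-wellFounded)
import Data.Nat.Properties as ℕ
open import Data.Product.Base using (∃; ∃-syntax; _×_; _,_; proj₁; proj₂)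
open import Data.Sum.Base as Sum using (_⊎_; inj₁; inj₂; [_,_]′)
open import Data.Vec.Base using ([]; _∷_; _++_; lookup; tabulate; here; there)
open import Data.Vec.Properties using ([]=⇒lookup; lookup⇒[]=; lookup∘tabulate; tabulate∘lookup; tabulate-cong;
  lookup-splitAt)
open import Function.Base using (_∘_; case_of_)
open import Function.Bundles using (_↔_; Inverse; mk↔ₛ′; mk⇔)
open import Relation.Binary.Construct.Closure.ReflexiveTransitive using (Star; ε; _◅_)
open import Relation.Binary.PropositionalEquality
open import Relation.Nullary using (¬_; Dec; yes; no; contradiction; does)
open import Relation.Nullary.Decidable using (¬?; _×-dec_; _⊎-dec_; _→-dec_; decidable-stable; from-yes; dec-true)
open import Relation.Unary using (Pred)

private
  variable
    m n k : ℕ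

-- Cardinality of subsets and exchange of elements

∣∣≡sum : (S : Subset n) → ∣ S ∣ ≡ sum ℕ.+-0-commutativeMonoid (λ i → if lookup S i then 1 else 0)
∣∣≡sum []            = refl
∣∣≡sum (inside ∷ S)  = cong suc (∣∣≡sum S)
∣∣≡sum (outside ∷ S) = ∣∣≡sum S

∣rearrange∣ : (π : Fin m ↔ Fin n) (S : Subset n) → ∣ tabulate (lookup S ∘ Inverse.to π) ∣ ≡ ∣ S ∣
∣rearrange∣ π S = begin
  ∣ tabulate (lookup S ∘ to) ∣
    ≡⟨ ∣∣≡sum (tabulate (lookup S ∘ to)) ⟩
  Σ (λ i → if lookup (tabulate (lookup S ∘ to)) i then 1 else 0)
    ≡⟨ sum-cong-≗ M (λ i → cong (if_then 1 else 0) (lookup∘tabulate (lookup S ∘ to) i)) ⟩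
  Σ (λ i → if lookup S (to i) then 1 else 0)
    ≡⟨ sum-permute M (λ i → if lookup S i then 1 else 0) π ⟨
  Σ (λ i → if lookup S i then 1 else 0)
    ≡⟨ ∣∣≡sum S ⟨
  ∣ S ∣ ∎
  where
  open ≡-Reasoning
  open Inverse π using (to)
  M = ℕ.+-0-commutativeMonoid
  Σ : ∀ {n} → (Fin n → ℕ) → ℕ
  Σ = sum M

∣++∣ : (X : Subset m) (Y : Subset k) → ∣ X ++ Y ∣ ≡ ∣ X ∣ + ∣ Y ∣
∣++∣ []            Y = refl
∣++∣ (inside ∷ X)  Y = cong suc (∣++∣ X Y)
∣++∣ (outside ∷ X) Y = ∣++∣ X Y

1≤∣∣ : {S : Subset n} {x : Fin n} → x ∈ S → 1 ≤ ∣ S ∣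
1≤∣∣ x∈S = ℕ.<-≤-trans (s≤s z≤n) (x∈p⇒∣p-x∣<∣p∣ x∈S)

2≤∣∣ : {S : Subset n} {x y : Fin n} → x ∈ S → y ∈ S → y ≢ x → 2 ≤ ∣ S ∣
2≤∣∣ x∈S y∈S y≢x = ℕ.≤-trans (s≤s (1≤∣∣ (x∈p∧x≢y⇒x∈p-y y∈S y≢x))) (x∈p⇒∣p-x∣<∣p∣ x∈S)

infixl 6 _[_↦_]

_[_↦_] : Subset n → Fin n → Fin n → Subset n
S [ x ↦ y ] = (S - x) ∪ ⁅ y ⁆

new∈[↦] : (S : Subset n) {x y : Fin n} → y ∈ S [ x ↦ y ]
new∈[↦] S {x} {y} = x∈p∪q⁺ {p = S - x} (inj₂ (x∈⁅x⁆ y))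

old∈[↦] : {S : Subset n} {x y z : Fin n} → z ∈ S → z ≢ x → z ∈ S [ x ↦ y ]
old∈[↦] {S = S} {x} {y} z∈S z≢x = x∈p∪q⁺ {q = ⁅ y ⁆} (inj₁ (x∈p∧x≢y⇒x∈p-y z∈S z≢x))

-- Only an inequality, because `y` may already belong to `S`.
∣[↦]∣≤ : {S : Subset n} {x y : Fin n} → x ∈ S → ∣ S [ x ↦ y ] ∣ ≤ ∣ S ∣
∣[↦]∣≤ {S = S} {x} {y} x∈S = begin
  ∣ (S - x) ∪ ⁅ y ⁆ ∣       ≤⟨ ∣∪∣≤ (S - x) ⁅ y ⁆ ⟩
  ∣ S - x ∣ + ∣ ⁅ y ⁆ ∣     ≡⟨ cong (∣ S - x ∣ +_) (∣⁅x⁆∣≡1 y) ⟩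
  ∣ S - x ∣ + 1             ≡⟨ ℕ.+-comm _ 1 ⟩
  suc ∣ S - x ∣             ≤⟨ x∈p⇒∣p-x∣<∣p∣ x∈S ⟩
  ∣ S ∣                     ∎
  where
  open ℕ.≤-Reasoning
  ∣∪∣≤ : ∀ {n} (X Y : Subset n) → ∣ X ∪ Y ∣ ≤ ∣ X ∣ + ∣ Y ∣
  ∣∪∣≤ []            []            = z≤n
  ∣∪∣≤ (outside ∷ X) (outside ∷ Y) = ∣∪∣≤ X Y
  ∣∪∣≤ (outside ∷ X) (inside ∷ Y)  = ℕ.≤-trans (s≤s (∣∪∣≤ X Y)) (ℕ.≤-reflexive (sym (ℕ.+-suc ∣ X ∣ ∣ Y ∣)))
  ∣∪∣≤ (inside ∷ X)  (outside ∷ Y) = s≤s (∣∪∣≤ X Y)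
  ∣∪∣≤ (inside ∷ X)  (inside ∷ Y)  = s≤s (ℕ.≤-trans (∣∪∣≤ X Y) (ℕ.+-monoʳ-≤ ∣ X ∣ (ℕ.n≤1+n _)))

lookup-injective : ∀ {a} {A : Set a} {xs : List A} → Unique xs →
                   ∀ i j → List.lookup xs i ≡ List.lookup xs j → i ≡ j
lookup-injective (px ∷ pxs) zero    zero    eq = refl
lookup-injective (px ∷ pxs) zero    (suc j) eq = contradiction eq (All.lookup px (∈ᴸ.∈-lookup j))
lookup-injective (px ∷ pxs) (suc i) zero    eq = contradiction (sym eq) (All.lookup px (∈ᴸ.∈-lookup i))
lookup-injective (px ∷ pxs) (suc i) (suc j) eq = cong suc (lookup-injective pxs i j eq)

∈-resp-lookup : ∀ {X : Subset n} {Y : Subset m} {x y} → lookup X x ≡ lookup Y y → x ∈ X → y ∈ Y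
∈-resp-lookup {Y = Y} {y = y} eq x∈X = lookup⇒[]= y Y (trans (sym eq) ([]=⇒lookup x∈X))

-- Total domination, end vertices and private neighbours

module _ (T : Graph n) where
  open Graph T

  TotallyDominates : Pred (Subset n) _
  TotallyDominates D = ∀ v → ∃[ u ] (u ∈ D × v ~ u)

  totallyDominates⇒ : ∀ {D} → TotallyDominates D → IsTotalDominating T D
  totallyDominates⇒ td = (λ v _ → td v) , (λ v _ → td v)

  ⇒totallyDominates : ∀ {D} → IsTotalDominating T D → TotallyDominates D
  ⇒totallyDominates {D} (dom , noIso) v with v ∈? D
  ... | yes v∈D = noIso v v∈D
  ... | no  v∉D = dom v v∉D

  -- A leaf together with its support; uniqueness of the neighbour takes the place of the degree
  -- count in `IsLeaf`.
  EndVertex : Fin n → Fin n → Set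
  EndVertex x y = x ~ y × (∀ {z} → x ~ z → z ≡ y)

  ∈N⁺ : ∀ {x y} → x ~ y → y ∈ N x
  ∈N⁺ {x} {y} x~y = lookup⇒[]= y (N x) (trans (lookup∘tabulate _ y) (dec-true (x ~? y) x~y))

  ∈N⁻ : ∀ {x y} → y ∈ N x → x ~ y
  ∈N⁻ {x} {y} y∈N with x ~? y | trans (sym (lookup∘tabulate (λ u → does (x ~? u)) y)) ([]=⇒lookup y∈N)
  ... | yes x~y | _ = x~y
  ... | no _    | ()

  -- Together with `pn⁻`, replaces the set equation in `pn` by a statement about single neighbours
  -- of `x`.
  pn⁺ : ∀ {S x v} → v ∈ S → x ~ v → (∀ {u} → u ∈ S → x ~ u → u ≡ v) → pn T v S x
  pn⁺ {S} {x} {v} v∈S x~v only = ⊆-antisym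
    (λ u∈ → let u∈N , u∈S = x∈p∩q⁻ (N x) S u∈ in
            subst (_∈ ⁅ v ⁆) (sym (only u∈S (∈N⁻ u∈N))) (x∈⁅x⁆ v))
    (λ u∈⁅v⁆ → subst (_∈ N x ∩ S) (sym (x∈⁅y⁆⇒x≡y v u∈⁅v⁆)) (x∈p∩q⁺ (∈N⁺ x~v , v∈S)))

  pn⁻ : ∀ {S x v} → pn T v S x → x ~ v × (∀ {u} → u ∈ S → x ~ u → u ≡ v)
  pn⁻ {S} {x} {v} eq =
    ∈N⁻ (proj₁ (x∈p∩q⁻ (N x) S (subst (v ∈_) (sym eq) (x∈⁅x⁆ v)))) ,
    λ u∈S x~u → x∈⁅y⁆⇒x≡y v (subst (_ ∈_) eq (x∈p∩q⁺ (∈N⁺ x~u , u∈S)))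

-- Removing a pendant path

pullback : Graph n → (Fin m → Fin n) → Graph m
pullback T ι = record
  { _~_      = λ i j → ι i ~ ι j
  ; _~?_     = λ i j → ι i ~? ι j
  ; ~-sym    = ~-sym
  ; ~-irrefl = λ { refl → ~-irrefl refl }
  }
  where open Graph T

-- `g` embeds `P k` as an induced subgraph whose only edge to the rest of `T` joins `p` to `g v`.
-- This is what makes `T` a sum of the rest with `P k`.
record Pendant (T : Graph n) (k : ℕ) (g : Fin k → Fin n) (v : Fin k) (p : Fin n) : Set where
  open Graph T
  field
    injective : ∀ i j → g i ≡ g j → i ≡ j
    avoids    : ∀ i → g i ≢ p
    inside~   : ∀ i j → Graph._~_ (P k) i j → g i ~ g j
    bridge~   : p ~ g v
    nbrs      : ∀ i {x} → g i ~ x →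
                (∃[ j ] (x ≡ g j × Graph._~_ (P k) i j)) ⊎ (x ≡ p × i ≡ v)

module Removal (T : Graph n) {g : Fin k → Fin n} {v : Fin k} {p : Fin n} (pendant : Pendant T k g v p) where
  open Graph T
  open Pendant pendant

  private
    Outside? : ∀ x → Dec (¬ (∃[ i ] g i ≡ x))
    Outside? x = ¬? (Fin.any? (λ i → g i Fin.≟ x))

    rest : List (Fin n)
    rest = filter Outside? (allFin n)

  -- Enumerates the vertices off the path, so that the subgraph induced on them is a graph on an
  -- initial segment of the naturals.
  ι : Fin (length rest) → Fin n
  ι = List.lookup rest

  ι-injective : ∀ i j → ι i ≡ ι j → i ≡ j
  ι-injective = lookup-injective (filter⁺ Outside? (allFin⁺ n))

  g≢ι : ∀ j i → g j ≢ ι i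
  g≢ι j i eq = proj₂ (∈ᴸ.∈-filter⁻ Outside? {xs = allFin n} (∈ᴸ.∈-lookup i)) (j , eq)

  locate : ∀ x → (∃[ i ] x ≡ ι i) ⊎ (∃[ j ] x ≡ g j)
  locate x with Fin.any? (λ i → g i Fin.≟ x)
  ... | yes (j , eq) = inj₂ (j , sym eq)
  ... | no  x∉g      = inj₁ (Any.index x∈rest , lookup-index x∈rest)
    where x∈rest = ∈ᴸ.∈-filter⁺ Outside? (∈ᴸ.∈-allFin x) x∉g

  outside-ι : ∀ {x} → (∀ j → x ≢ g j) → ∃[ i ] x ≡ ι i
  outside-ι {x} x∉g with locate x
  ... | inj₁ found    = found
  ... | inj₂ (j , eq) = contradiction eq (x∉g j)

  T′ : Graph (length rest)
  T′ = pullback T ι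

  private
    module T′ = Graph T′

    join-ι,g : Fin (length rest) ⊎ Fin k → Fin n
    join-ι,g = [ ι , g ]′

    from : Fin n → Fin (length rest + k)
    from x = join _ k (Sum.map proj₁ proj₁ (locate x))

  locate-ι : ∀ i → Sum.map proj₁ proj₁ (locate (ι i)) ≡ inj₁ i
  locate-ι i with locate (ι i)
  ... | inj₁ (i′ , eq) = cong inj₁ (sym (ι-injective i i′ eq))
  ... | inj₂ (j , eq)  = contradiction (sym eq) (g≢ι j i)

  locate-g : ∀ j → Sum.map proj₁ proj₁ (locate (g j)) ≡ inj₂ j
  locate-g j with locate (g j)
  ... | inj₁ (i , eq)  = contradiction eq (g≢ι j i)
  ... | inj₂ (j′ , eq) = cong inj₂ (sym (injective j j′ eq))

  bijection : Fin (length rest + k) ↔ Fin n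
  bijection = mk↔ₛ′ (λ z → join-ι,g (splitAt _ z)) from to∘from from∘to
    where
    to∘from : ∀ x → join-ι,g (splitAt _ (from x)) ≡ x
    to∘from x rewrite Fin.splitAt-join (length rest) k (Sum.map proj₁ proj₁ (locate x)) with locate x
    ... | inj₁ (i , eq) = sym eq
    ... | inj₂ (j , eq) = sym eq
    located : ∀ s → Sum.map proj₁ proj₁ (locate (join-ι,g s)) ≡ s
    located (inj₁ i) = locate-ι i
    located (inj₂ j) = locate-g j
    from∘to : ∀ z → from (join-ι,g (splitAt _ z)) ≡ z
    from∘to z = trans (cong (join _ k) (located (splitAt _ z))) (Fin.join-splitAt _ k z)

  size : length rest + k ≡ n
  size = ↔⇒≡ bijection

  u : Fin (length rest)
  u = proj₁ (outside-ι (λ j → ≢-sym (avoids j)))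

  p≡ιu : p ≡ ι u
  p≡ιu = proj₂ (outside-ι (λ j → ≢-sym (avoids j)))

  ι~g : ∀ {i j} → g j ~ ι i → i ≡ u × j ≡ v
  ι~g {i} {j} e with nbrs j e
  ... | inj₁ (j′ , eq , _) = contradiction (sym eq) (g≢ι j′ i)
  ... | inj₂ (eq , j≡v)    = ι-injective i u (trans eq p≡ιu) , j≡v

  g~g : ∀ {i j} → g i ~ g j → Graph._~_ (P k) i j
  g~g {i} {j} e with nbrs i e
  ... | inj₁ (j′ , eq , e′) rewrite injective j j′ eq = e′
  ... | inj₂ (eq , _)       = contradiction eq (avoids j)

  sum≅ : T′ +⟨ u , v ⟩ P k ≅ T
  sum≅ = record
    { bijection = bijection
    ; preserves = λ x y → mk⇔ (⇒ (splitAt _ x) (splitAt _ y)) (⇐ (splitAt _ x) (splitAt _ y))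
    }
    where
    ⇒ : ∀ s t → SumAdj T′ (P k) u v s t → join-ι,g s ~ join-ι,g t
    ⇒ _ _ (left e)  = e
    ⇒ _ _ (right e) = inside~ _ _ e
    ⇒ _ _ bridge    = subst (_~ g v) p≡ιu bridge~
    ⇒ _ _ bridge⁻   = ~-sym (subst (_~ g v) p≡ιu bridge~)
    ⇐ : ∀ s t → join-ι,g s ~ join-ι,g t → SumAdj T′ (P k) u v s t
    ⇐ (inj₁ _) (inj₁ _) e = left e
    ⇐ (inj₂ _) (inj₂ _) e = right (g~g e)
    ⇐ (inj₁ _) (inj₂ _) e with refl , refl ← ι~g (~-sym e) = bridge
    ⇐ (inj₂ _) (inj₁ _) e with refl , refl ← ι~g e = bridge⁻

  -- Collapsing the whole path onto `u` turns a walk in `T` into one in `T′`: the bridge is the only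
  -- edge leaving the path, and its other end is `u`.
  connected′ : Connected → T′.Connected
  connected′ conn i j = subst₂ (Star T′._~_) (retract-ι i) (retract-ι j) (walk (conn (ι i) (ι j)))
    where
    retract : Fin n → Fin (length rest)
    retract x = [ proj₁ , (λ _ → u) ]′ (locate x)
    retract-ι : ∀ i → retract (ι i) ≡ i
    retract-ι i with locate (ι i)
    ... | inj₁ (i′ , eq) = sym (ι-injective i i′ eq)
    ... | inj₂ (j , eq)  = contradiction (sym eq) (g≢ι j i)
    edge : ∀ {x y} → x ~ y → Star T′._~_ (retract y) j → Star T′._~_ (retract x) j
    edge {x} {y} e rec with locate x | locate y
    ... | inj₁ (i₁ , refl) | inj₁ (i₂ , refl) = e ◅ rec
    ... | inj₂ (j₁ , refl) | inj₂ (j₂ , refl) = rec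
    ... | inj₁ (i₁ , refl) | inj₂ (j₂ , refl) with refl , _ ← ι~g (~-sym e) = rec
    ... | inj₂ (j₁ , refl) | inj₁ (i₂ , refl) with refl , _ ← ι~g e = rec
    walk′ : ∀ {x y} → Star _~_ x y → Star T′._~_ (retract y) j → Star T′._~_ (retract x) j
    walk′ ε        rec = rec
    walk′ (e ◅ es) rec = edge e (walk′ es rec)
    walk : ∀ {x} → Star _~_ x (ι j) → Star T′._~_ (retract x) (retract (ι j))
    walk s = subst (Star T′._~_ _) (sym (retract-ι j))
      (walk′ s (subst (λ z → Star T′._~_ z j) (sym (retract-ι j)) ε))

  glue : Subset (length rest) → Subset k → Subset n
  glue X Y = tabulate (λ x → [ lookup X , lookup Y ]′ (Sum.map proj₁ proj₁ (locate x)))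

  lookup-glue-ι : ∀ X Y i → lookup (glue X Y) (ι i) ≡ lookup X i
  lookup-glue-ι X Y i = trans (lookup∘tabulate _ (ι i)) (cong [ lookup X , lookup Y ]′ (locate-ι i))

  lookup-glue-g : ∀ X Y j → lookup (glue X Y) (g j) ≡ lookup Y j
  lookup-glue-g X Y j = trans (lookup∘tabulate _ (g j)) (cong [ lookup X , lookup Y ]′ (locate-g j))

  ∈-glueˡ : ∀ X Y {i} → i ∈ X → ι i ∈ glue X Y
  ∈-glueˡ X Y {i} = ∈-resp-lookup (sym (lookup-glue-ι X Y i))

  ∈-glueʳ : ∀ X Y {j} → j ∈ Y → g j ∈ glue X Y
  ∈-glueʳ X Y {j} = ∈-resp-lookup (sym (lookup-glue-g X Y j))

  -- Along `bijection`, the set `glue X Y` becomes the concatenation of the two vectors.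
  ∣glue∣ : ∀ X Y → ∣ glue X Y ∣ ≡ ∣ X ∣ + ∣ Y ∣
  ∣glue∣ X Y = begin
    ∣ glue X Y ∣                                                  ≡⟨ ∣rearrange∣ bijection (glue X Y) ⟨
    ∣ tabulate (lookup (glue X Y) ∘ Inverse.to bijection) ∣  ≡⟨ cong ∣_∣ (tabulate-cong pointwise) ⟩
    ∣ tabulate (lookup (X ++ Y)) ∣                             ≡⟨ cong ∣_∣ (tabulate∘lookup (X ++ Y)) ⟩
    ∣ X ++ Y ∣                                                    ≡⟨ ∣++∣ X Y ⟩
    ∣ X ∣ + ∣ Y ∣                                                 ∎
    where
    open ≡-Reasoning
    parts : ∀ s → lookup (glue X Y) (join-ι,g s) ≡ [ lookup X , lookup Y ]′ s
    parts (inj₁ i) = lookup-glue-ι X Y i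
    parts (inj₂ j) = lookup-glue-g X Y j
    pointwise : ∀ z → lookup (glue X Y) (Inverse.to bijection z) ≡ lookup (X ++ Y) z
    pointwise z = trans (parts (splitAt _ z)) (sym (lookup-splitAt (length rest) X Y z))

  restrict : Subset n → Subset (length rest)
  restrict S = tabulate (lookup S ∘ ι)

  removed : Subset n → Subset k
  removed S = tabulate (lookup S ∘ g)

  ∈-restrict⁺ : ∀ {S i} → ι i ∈ S → i ∈ restrict S
  ∈-restrict⁺ {S} {i} = ∈-resp-lookup (sym (lookup∘tabulate (lookup S ∘ ι) i))

  ∈-removed⁺ : ∀ {S j} → g j ∈ S → j ∈ removed S
  ∈-removed⁺ {S} {j} = ∈-resp-lookup (sym (lookup∘tabulate (lookup S ∘ g) j))

  ∣restrict∣ : ∀ S → ∣ S ∣ ≡ ∣ restrict S ∣ + ∣ removed S ∣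
  ∣restrict∣ S = trans (cong ∣_∣ (trans (sym (tabulate∘lookup S)) (tabulate-cong pointwise)))
    (∣glue∣ (restrict S) (removed S))
    where
    pointwise : ∀ x → lookup S x ≡ [ lookup (restrict S) , lookup (removed S) ]′ (Sum.map proj₁ proj₁ (locate x))
    pointwise x with locate x
    ... | inj₁ (i , refl) = sym (lookup∘tabulate (lookup S ∘ ι) i)
    ... | inj₂ (j , refl) = sym (lookup∘tabulate (lookup S ∘ g) j)

  -- Each cover or total dominating set of `T′` extends to `T` at a cost of at most `c`, while `S`
  -- spends at least `c` on the path. Hence a set of `T′` smaller than `restrict S` would extend to
  -- one smaller than `S`. The vertex `w` keeps `p` dominated once the path is gone.
  restrict-γₜ-τ : ∀ {S w} → γₜ-τ-Set T S →
                  w ∈ S → p ~ w → (∀ j → w ≢ g j) →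
                  ∀ {c} → c ≤ ∣ removed S ∣ →
                  (∀ X → IsVertexCover T′ X → ∃[ X⁺ ] (IsVertexCover T X⁺ × ∣ X⁺ ∣ ≤ ∣ X ∣ + c)) →
                  (∀ D → TotallyDominates T′ D → ∃[ D⁺ ] (TotallyDominates T D⁺ × ∣ D⁺ ∣ ≤ ∣ D ∣ + c)) →
                  γₜ-τ-Set T′ (restrict S)
  restrict-γₜ-τ {S} {w} ((td , _ , minD) , (vc , _ , minX)) w∈S p~w w∉g {c} c≤ extendX extendD =
    (td′ , (restrict S , td′ , refl) , λ D tdD →
      let D⁺ , td⁺ , D⁺≤ = extendD D (⇒totallyDominates T′ tdD)
      in cancel (minD D⁺ (totallyDominates⇒ T td⁺)) D⁺≤) ,
    (vc′ , (restrict S , vc′ , refl) , λ X vcX →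
      let X⁺ , vc⁺ , X⁺≤ = extendX X vcX
      in cancel (minX X⁺ vc⁺) X⁺≤)
    where
    vc′ : IsVertexCover T′ (restrict S)
    vc′ i j e = Sum.map ∈-restrict⁺ ∈-restrict⁺ (vc (ι i) (ι j) e)
    dominate : TotallyDominates T′ (restrict S)
    dominate i with x , x∈S , e ← ⇒totallyDominates T td (ι i) | locate x
    ... | inj₁ (i′ , refl) = i′ , ∈-restrict⁺ x∈S , e
    -- A dominator on the path is possible only for `u`; there `w` replaces it.
    ... | inj₂ (j , refl) with refl , _ ← ι~g (~-sym e) | i′ , refl ← outside-ι w∉g =
      i′ , ∈-restrict⁺ w∈S , subst (_~ ι i′) p≡ιu p~w
    td′ = totallyDominates⇒ T′ dominate
    cancel : ∀ {a b} → ∣ S ∣ ≤ a → a ≤ b + c → ∣ restrict S ∣ ≤ b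
    cancel {a} {b} S≤a a≤b+c = ℕ.+-cancelʳ-≤ c _ _ (begin
      ∣ restrict S ∣ + c                ≤⟨ ℕ.+-monoʳ-≤ ∣ restrict S ∣ c≤ ⟩
      ∣ restrict S ∣ + ∣ removed S ∣    ≡⟨ ∣restrict∣ S ⟨
      ∣ S ∣                             ≤⟨ S≤a ⟩
      a                                 ≤⟨ a≤b+c ⟩
      b + c                             ∎)
      where open ℕ.≤-Reasoning

  glue-cover : ∀ {X Y} → IsVertexCover T′ X → IsVertexCover (P k) Y → u ∈ X ⊎ v ∈ Y →
               IsVertexCover T (glue X Y)
  glue-cover {X} {Y} vcX vcY bridged x y e with locate x | locate y
  ... | inj₁ (i , refl) | inj₁ (j , refl) = Sum.map (∈-glueˡ X Y) (∈-glueˡ X Y) (vcX i j e)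
  ... | inj₂ (i , refl) | inj₂ (j , refl) = Sum.map (∈-glueʳ X Y) (∈-glueʳ X Y) (vcY i j (g~g e))
  ... | inj₁ (i , refl) | inj₂ (j , refl) with refl , refl ← ι~g (~-sym e) =
    Sum.map (∈-glueˡ X Y) (∈-glueʳ X Y) bridged
  ... | inj₂ (i , refl) | inj₁ (j , refl) with refl , refl ← ι~g e =
    Sum.swap (Sum.map (∈-glueˡ X Y) (∈-glueʳ X Y) bridged)

  -- The two sides may help each other across the bridge: `u` may be dominated by the attached path
  -- vertex and conversely.
  glue-dominates : ∀ X Y →
                   (∀ i → (∃[ i′ ] (i′ ∈ X × i T′.~ i′)) ⊎ (i ≡ u × v ∈ Y)) →
                   (∀ j → (∃[ j′ ] (j′ ∈ Y × Graph._~_ (P k) j j′)) ⊎ (j ≡ v × u ∈ X)) →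
                   TotallyDominates T (glue X Y)
  glue-dominates X Y domX domY x with locate x
  ... | inj₁ (i , refl) with domX i
  ...   | inj₁ (i′ , i′∈X , e) = ι i′ , ∈-glueˡ X Y i′∈X , e
  ...   | inj₂ (refl , v∈Y)    = g v , ∈-glueʳ X Y v∈Y , subst (_~ g v) p≡ιu bridge~
  glue-dominates X Y domX domY x | inj₂ (j , refl) with domY j
  ...   | inj₁ (j′ , j′∈Y , e) = g j′ , ∈-glueʳ X Y j′∈Y , inside~ _ _ e
  ...   | inj₂ (refl , u∈X)    = ι u , ∈-glueˡ X Y u∈X , ~-sym (subst (_~ g v) p≡ιu bridge~)

  endVertex′ : ∀ {i j} → EndVertex T (ι i) (ι j) → EndVertex T′ i j
  endVertex′ (e , only) = e , λ e′ → ι-injective _ _ (only e′)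

  smaller : length rest < n
  smaller = subst (length rest <_) size (ℕ.m<m+n _ (0<k v))
    where
    0<k : ∀ {k} → Fin k → 0 < k
    0<k {suc k} _ = s≤s z≤n

-- Heights of branches

-- In Height≤ h a b, the vertex a is the parent of b.  Since b is not its own
-- neighbour, Height≤ h b b is the statement for a root b, which has no parent.
module _ (T : Graph n) where
  open Graph T

  Height≤ : ℕ → Fin n → Fin n → Set
  Height≤ zero    a b = ∀ c → b ~ c → c ≡ a
  Height≤ (suc h) a b = ∀ c → b ~ c → c ≢ a → Height≤ h b c

  Height≤? : ∀ h a b → Dec (Height≤ h a b)
  Height≤? zero    a b = Fin.all? λ c → (b ~? c) →-dec (c Fin.≟ a)
  Height≤? (suc h) a b = Fin.all? λ c → (b ~? c) →-dec (¬? (c Fin.≟ a) →-dec Height≤? h b c)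

  Height≤-mono : ∀ h {a b} → Height≤ h a b → Height≤ (suc h) a b
  Height≤-mono zero    H c e c≢a = contradiction (H c e) c≢a
  Height≤-mono (suc h) H c e c≢a = Height≤-mono h (H c e c≢a)

  tall-child : ∀ h {a b} → ¬ Height≤ (suc h) a b → ∃[ c ] (b ~ c × c ≢ a × ¬ Height≤ h b c)
  tall-child h {a} {b} tall
    with Fin.any? (λ c → (b ~? c) ×-dec ¬? (c Fin.≟ a) ×-dec ¬? (Height≤? h b c))
  ... | yes found = found
  ... | no  none  = contradiction
    (λ c e c≢a → decidable-stable (Height≤? h b c) λ ¬H → none (c , e , c≢a , ¬H)) tall

  tall-child₀ : ∀ {a b} → ¬ Height≤ 0 a b → ∃[ c ] (b ~ c × c ≢ a)
  tall-child₀ {a} {b} tall with Fin.any? (λ c → (b ~? c) ×-dec ¬? (c Fin.≟ a))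
  ... | yes found = found
  ... | no  none  = contradiction
    (λ c e → decidable-stable (c Fin.≟ a) λ c≢a → none (c , e , c≢a)) tall

  -- Descend to a child whose branch is still higher than `t` until the height is exactly `t + 1`;
  -- the bound `h` makes the descent end.
  branch-of-height : ∀ t h {a b} → Height≤ h a b → ¬ Height≤ t a b →
                     ∃[ a′ ] ∃[ b′ ] (Height≤ (suc t) a′ b′ × ¬ Height≤ t a′ b′)
  branch-of-height t h {a} {b} H tall with Height≤? (suc t) a b
  ... | yes H′ = a , b , H′ , tall
  branch-of-height t zero    H tall | no tall′ = contradiction (zero-mono t H) tall
    where
    zero-mono : ∀ t {a b} → Height≤ 0 a b → Height≤ t a b
    zero-mono zero    H = H
    zero-mono (suc t) H = Height≤-mono t (zero-mono t H)
  branch-of-height t (suc h) H tall | no tall′ =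
    let c , e , c≢a , tallᶜ = tall-child t tall′ in branch-of-height t h (H c e c≢a) tallᶜ

  module _ (acyclic : Acyclic) where
    private
      Path : List (Fin n) → Set
      Path xs = Unique xs × Linked _~_ xs

      -- Cuts the path just after `c`. The last component appends any neighbour of `c`, which is how
      -- a cycle gets closed.
      prefix-to : ∀ {c} y vs → c ∈ᴸ vs → Path (y ∷ vs) →
                  ∃[ ws ] (ws ⊆ᴸ vs × Path (y ∷ ws) × 1 ≤ length ws ×
                           (∀ {x} → c ~ x → Linked _~_ ((y ∷ ws) ∷ʳ x)))
      prefix-to y (c ∷ vs) (here refl) (((y≢c ∷ _) ∷ _) , (e ∷ _)) =
        (c ∷ []) , (λ { (here eq) → here eq }) ,
        (((y≢c ∷ []) ∷ [] ∷ []) , (e ∷ [-])) , s≤s z≤n , λ c~x → e ∷ c~x ∷ [-]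
      prefix-to y (z ∷ vs) (there c∈vs) ((y∉ ∷ u) , (e ∷ l)) =
        let ws , ws⊆ , (uw , lw) , _ , close = prefix-to z vs c∈vs (u , l)
            sub = ∷⁺ʳ z ws⊆
        in (z ∷ ws) , sub ,
           ((All.tabulate (λ w∈ → All.lookup y∉ (sub w∈)) ∷ uw) , (e ∷ lw)) ,
           s≤s z≤n , λ c~x → e ∷ close c~x

      -- If `c` were already on the path beyond `y`, the piece from `x` to `c` and the edge back to
      -- `x` would form a cycle.
      extend : ∀ {x y vs c} → Path (x ∷ y ∷ vs) → x ~ c → c ≢ y → Path (c ∷ x ∷ y ∷ vs)
      extend {x} {y} {vs} {c} path@(u@(x∉ ∷ _) , l@(e ∷ l′)) x~c c≢y =
        (All.tabulate fresh ∷ u) , (~-sym x~c ∷ l)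
        where
        fresh : ∀ {z} → z ∈ᴸ x ∷ y ∷ vs → c ≢ z
        fresh (here refl)          refl = ~-irrefl refl x~c
        fresh (there (here refl))  eq   = c≢y eq
        fresh (there (there z∈vs)) refl =
          let ws , ws⊆ , (uw , lw) , 1≤ , close = prefix-to y vs z∈vs (AllPairs.tail u , l′)
              sub = ∷⁺ʳ y ws⊆
          in acyclic x (y ∷ ws)
               ( s≤s (s≤s 1≤)
               , (All.tabulate (λ w∈ → All.lookup x∉ (sub w∈)) ∷ uw)
               , e ∷ close (~-sym x~c))

      unique-length : ∀ {xs} → Unique xs → length xs ≤ n
      unique-length u = Fin.injective⇒≤ (lookup-injective u _ _)

      -- The path is listed from its newest vertex `x` backwards, so `y` is the parent of `x`. Each
      -- descent trades one unit of `h` for one more vertex; at `h = 0` the path would have more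
      -- than `n` distinct vertices.
      height-from-path : ∀ h {x y vs} → Path (x ∷ y ∷ vs) → n ≤ h + length (y ∷ vs) → Height≤ h y x
      height-from-path zero {x} {y} path n≤ c e = decidable-stable (c Fin.≟ y) λ c≢y →
        contradiction (unique-length (proj₁ path)) (ℕ.<⇒≱ (s≤s n≤))
      height-from-path (suc h) path n≤ c e c≢y =
        height-from-path h (extend path e c≢y) (ℕ.≤-trans n≤ (ℕ.≤-reflexive (sym (ℕ.+-suc h _))))

    acyclic⇒bounded : ∀ b → Height≤ (suc n) b b
    acyclic⇒bounded b c e c≢b =
      height-from-path n ((((c≢b ∷ []) ∷ [] ∷ [])) , (~-sym e ∷ [-])) (ℕ.m≤m+n n 1)

-- The induction carries a height bound in place of acyclicity; this passes the bound on to the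
-- smaller graph.
pullback-height : (T : Graph n) (ι : Fin m → Fin n) → (∀ i j → ι i ≡ ι j → i ≡ j) →
                  ∀ h {a b} → Height≤ T h (ι a) (ι b) → Height≤ (pullback T ι) h a b
pullback-height T ι inj zero    H c e     = inj _ _ (H (ι c) e)
pullback-height T ι inj (suc h) H c e c≢a = pullback-height T ι inj h (H (ι c) e (λ eq → c≢a (inj _ _ eq)))

-- Exchange arguments at leaves

module _ (T : Graph n) where
  open Graph T

  support-dominates : ∀ {D x y} → TotallyDominates T D → EndVertex T x y → y ∈ D
  support-dominates {x = x} td (_ , only) =
    let w , w∈D , e = td x in subst (_∈ _) (only e) w∈D

  -- If `y` is missing, the leaf `x` must cover its edge. This is the only edge at `x`, so `x` can
  -- be exchanged for `y`.
  cover-with-support : ∀ {X x y} → EndVertex T x y → IsVertexCover T X →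
                       ∃[ X′ ] (IsVertexCover T X′ × y ∈ X′ × ∣ X′ ∣ ≤ ∣ X ∣)
  cover-with-support {X} {x} {y} (x~y , only) vc with y ∈? X
  ... | yes y∈X = X , vc , y∈X , ℕ.≤-refl
  ... | no  y∉X = X [ x ↦ y ] , vc′ , new∈[↦] X , ∣[↦]∣≤ x∈X
    where
    x∈X : x ∈ X
    x∈X = [ (λ x∈X → x∈X) , (λ y∈X → contradiction y∈X y∉X) ]′ (vc x y x~y)
    vc′ : IsVertexCover T (X [ x ↦ y ])
    vc′ a b a~b with a Fin.≟ x | b Fin.≟ x
    ... | yes refl | _        = inj₂ (subst (_∈ _) (sym (only a~b)) (new∈[↦] X))
    ... | no _     | yes refl = inj₁ (subst (_∈ _) (sym (only (~-sym a~b))) (new∈[↦] X))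
    ... | no a≢x   | no b≢x   = Sum.map (λ a∈X → old∈[↦] a∈X a≢x) (λ b∈X → old∈[↦] b∈X b≢x) (vc a b a~b)

  -- If `z` is missing, `y` is dominated by the leaf `x`. Since `x` dominates nothing but `y`, and
  -- `z` is adjacent to `y`, the two can be exchanged.
  dominating-with-end : ∀ {D x y z} → EndVertex T x y → y ~ z → (∀ {a} → y ~ a → a ≡ z ⊎ a ≡ x) →
                        TotallyDominates T D →
                        ∃[ D′ ] (TotallyDominates T D′ × z ∈ D′ × ∣ D′ ∣ ≤ ∣ D ∣)
  dominating-with-end {D} {x} {y} {z} (x~y , only) y~z Ny td with z ∈? D
  ... | yes z∈D = D , td , z∈D , ℕ.≤-refl
  ... | no  z∉D = D [ x ↦ z ] , td′ , new∈[↦] D , ∣[↦]∣≤ x∈D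
    where
    x∈D : x ∈ D
    x∈D with w , w∈D , e ← td y | Ny e
    ... | inj₁ refl = contradiction w∈D z∉D
    ... | inj₂ refl = w∈D
    td′ : TotallyDominates T (D [ x ↦ z ])
    td′ a with w , w∈D , e ← td a | w Fin.≟ x
    ... | no w≢x   = w , old∈[↦] w∈D w≢x , e
    ... | yes refl = z , new∈[↦] D , subst (_~ z) (sym (only (~-sym e))) y~z

-- Paths given by lists, and sets on short paths

linked-lookup : ∀ {a ℓ} {A : Set a} {R : A → A → Set ℓ} {xs} → Linked R xs →
                ∀ i j → suc (toℕ i) ≡ toℕ j → R (List.lookup xs i) (List.lookup xs j)
linked-lookup (r ∷ rs) zero    (suc zero) eq = r
linked-lookup (r ∷ rs) (suc i) (suc j)    eq = linked-lookup rs i j (ℕ.suc-injective eq)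

linked⇒P : (T : Graph n) {xs : List (Fin n)} → Linked (Graph._~_ T) xs →
           ∀ i j → Graph._~_ (P (length xs)) i j → Graph._~_ T (List.lookup xs i) (List.lookup xs j)
linked⇒P T l i j (inj₁ eq) = linked-lookup l i j eq
linked⇒P T l i j (inj₂ eq) = Graph.~-sym T (linked-lookup l j i eq)

module _ (T : Graph n) where
  open Graph T

  pendant-path : {xs : List (Fin n)} {v : Fin (length xs)} {p : Fin n} →
                 Unique xs → Linked _~_ xs → All (p ≢_) xs → p ~ List.lookup xs v →
                 (∀ i {x} → List.lookup xs i ~ x →
                   (∃[ j ] (x ≡ List.lookup xs j × Graph._~_ (P (length xs)) i j)) ⊎ (x ≡ p × i ≡ v)) →
                 Pendant T (length xs) (List.lookup xs) v p
  pendant-path unique linked p∉ p~v nbrs = record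
    { injective = lookup-injective unique
    ; avoids    = λ i eq → All.lookup p∉ (∈ᴸ.∈-lookup i) (sym eq)
    ; inside~   = linked⇒P T linked
    ; bridge~   = p~v
    ; nbrs      = nbrs
    }

  -- No edge leaves the path, so by connectedness it contains every vertex.
  spanning-path : {x : Fin n} {xs : List (Fin n)} → Connected →
                  Unique (x ∷ xs) → Linked _~_ (x ∷ xs) →
                  (∀ i {y} → List.lookup (x ∷ xs) i ~ y →
                    ∃[ j ] (y ≡ List.lookup (x ∷ xs) j × Graph._~_ (P (length (x ∷ xs))) i j)) →
                  P (length (x ∷ xs)) ≅ T
  spanning-path {x} {xs} connected unique linked nbrs = record
    { bijection = mk↔ₛ′ g (proj₁ ∘ spans)
        (λ y → sym (proj₂ (spans y))) (λ i → injective _ _ (sym (proj₂ (spans (g i)))))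
    ; preserves = λ i j → mk⇔ (linked⇒P T linked i j) (reflects i j)
    }
    where
    g = List.lookup (x ∷ xs)
    injective = lookup-injective unique
    walk : ∀ {y z} → (∃[ i ] y ≡ g i) → Star _~_ y z → ∃[ i ] z ≡ g i
    walk found         ε        = found
    walk (i , refl) (e ◅ es) = let j , eq , _ = nbrs i e in walk (j , eq) es
    spans : ∀ y → ∃[ i ] y ≡ g i
    spans y = walk (zero , refl) (connected x y)
    reflects : ∀ i j → g i ~ g j → Graph._~_ (P (length (x ∷ xs))) i j
    reflects i j e with j′ , eq , e′ ← nbrs i e rewrite injective j j′ eq = e′

-- This and `totallyDominates?` let claims about concrete short paths be settled by evaluation.
vertexCover? : (T : Graph n) (X : Subset n) → Dec (IsVertexCover T X)
vertexCover? T X = Fin.all? λ u → Fin.all? λ v → (u ~? v) →-dec ((u ∈? X) ⊎-dec (v ∈? X))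
  where open Graph T

totallyDominates? : (T : Graph n) (D : Subset n) → Dec (TotallyDominates T D)
totallyDominates? T D = Fin.all? λ v → Fin.any? λ u → (u ∈? D) ×-dec (v ~? u)
  where open Graph T

-- The two supports of `P 4`: one set that extends both covers and total dominating sets over a
-- removed path, at cost two.
middle : Subset 4
middle = outside ∷ inside ∷ inside ∷ outside ∷ []

middle-covers : IsVertexCover (P 4) middle
middle-covers = from-yes (vertexCover? (P 4) middle)

middle-dominates : TotallyDominates (P 4) middle
middle-dominates = from-yes (totallyDominates? (P 4) middle)

-- Consequences of minimality for a (γₜ-τ)-set

Bounded : Graph n → Set
Bounded T = ∃[ h ] ∀ b → Height≤ T h b b

module Reduction
  (T : Graph n) (connected : Graph.Connected T) (bounded : Bounded T)
  (hyp : ∀ {m} (T′ : Graph m) → m < n → Graph.Connected T′ → Bounded T′ → Fin m →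
         ∃ (γₜ-τ-Set T′) → 𝒯 T′)
  (S : Subset n) (γτ : γₜ-τ-Set T S)
  where
  open Graph T

  Leaf : Fin n → Fin n → Set
  Leaf = EndVertex T

  covers : IsVertexCover T S
  covers = proj₁ (proj₂ γτ)

  covers-minimal : ∀ X → IsVertexCover T X → ∣ S ∣ ≤ ∣ X ∣
  covers-minimal = proj₂ (proj₂ (proj₂ γτ))

  dominates : TotallyDominates T S
  dominates = ⇒totallyDominates T (proj₁ (proj₁ γτ))

  dominates-minimal : ∀ D → TotallyDominates T D → ∣ S ∣ ≤ ∣ D ∣
  dominates-minimal D td = proj₂ (proj₂ (proj₁ γτ)) D (totallyDominates⇒ T td)

  ≁-self : ∀ {x y} → x ~ y → x ≢ y
  ≁-self e eq = ~-irrefl eq e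

  nbr∈S : ∀ {x y} → x ∉ S → x ~ y → y ∈ S
  nbr∈S x∉S e = [ (λ x∈S → contradiction x∈S x∉S) , (λ y∈S → y∈S) ]′ (covers _ _ e)

  -- If all neighbours of `x` were in `S`, then `S - x` would still be a vertex cover.
  outer-nbr : ∀ {x} → x ∈ S → ∃[ y ] (y ∉ S × x ~ y)
  outer-nbr {x} x∈S with Fin.any? (λ y → ¬? (y ∈? S) ×-dec (x ~? y))
  ... | yes found = found
  ... | no  none  = contradiction (covers-minimal (S - x) vc) (ℕ.<⇒≱ (x∈p⇒∣p-x∣<∣p∣ x∈S))
    where
    inner : ∀ {y} → x ~ y → y ∈ S - x
    inner {y} e = x∈p∧x≢y⇒x∈p-y
      (decidable-stable (y ∈? S) λ y∉S → none (y , y∉S , e)) (≢-sym (≁-self e))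
    vc : IsVertexCover T (S - x)
    vc a b e with a Fin.≟ x | b Fin.≟ x
    ... | yes refl | _        = inj₂ (inner e)
    ... | no _     | yes refl = inj₁ (inner (~-sym e))
    ... | no a≢x   | no b≢x   =
      Sum.map (λ a∈S → x∈p∧x≢y⇒x∈p-y a∈S a≢x) (λ b∈S → x∈p∧x≢y⇒x∈p-y b∈S b≢x) (covers a b e)

  -- If every vertex had a neighbour in `S` other than `v`, then `S - v` would still be totally
  -- dominating.
  private-nbr : ∀ {v} → v ∈ S → ∃[ x ] (x ~ v × (∀ {u} → u ∈ S → x ~ u → u ≡ v))
  private-nbr {v} v∈S with Fin.all? (λ x → Fin.any? (λ u → (u ∈? S) ×-dec (x ~? u) ×-dec ¬? (u Fin.≟ v)))
  ... | yes td = contradiction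
    (dominates-minimal (S - v) λ x → let u , u∈S , e , u≢v = td x in u , x∈p∧x≢y⇒x∈p-y u∈S u≢v , e)
    (ℕ.<⇒≱ (x∈p⇒∣p-x∣<∣p∣ v∈S))
  ... | no ¬td = x , x~v , only
    where
    undominated = Fin.¬∀⟶∃¬ n _ (λ x → Fin.any? (λ u → (u ∈? S) ×-dec (x ~? u) ×-dec ¬? (u Fin.≟ v))) ¬td
    x = proj₁ undominated
    only : ∀ {u} → u ∈ S → x ~ u → u ≡ v
    only {u} u∈S e = decidable-stable (u Fin.≟ v) λ u≢v → proj₂ undominated (u , u∈S , e , u≢v)
    x~v : x ~ v
    x~v = let u , u∈S , e = dominates x in subst (x ~_) (only u∈S e) e

  -- The only neighbour of a leaf is its support, which lies in `S`; a leaf in `S` would thus have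
  -- no neighbour outside `S`.
  leaf∉S : ∀ {x y} → Leaf x y → x ∉ S
  leaf∉S leaf x∈S =
    let z , z∉S , e = outer-nbr x∈S
    in z∉S (subst (_∈ S) (sym (proj₂ leaf e)) (support-dominates T dominates leaf))

  -- Undoing one operation

  reduce : ∀ {k g v p} (pendant : Pendant T k g v p) →
           Removal.T′ T pendant ⟶ Removal.T′ T pendant +⟨ Removal.u T pendant , v ⟩ P k →
           γₜ-τ-Set (Removal.T′ T pendant) (Removal.restrict T pendant S) → 𝒯 T
  reduce pendant op γτ′ =
    -- The induction hypothesis handles the smaller graph, `op` reattaches the path, and `sum≅`
    -- identifies the result with `T`.
    𝒯.iso (step (hyp T′ smaller (connected′ connected) bounded′ u (restrict S , γτ′)) op) sum≅
    where
    open Removal T pendant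
    bounded′ : Bounded T′
    bounded′ = proj₁ bounded , λ b → pullback-height T ι ι-injective (proj₁ bounded) (proj₂ bounded (ι b))

  -- Undoes `O₂` by removing `x′`. The remaining leaf `x` forces `y` into each total dominating set,
  -- and into a cover after an exchange, so both kinds of set extend at no cost.
  two-leaves : ∀ {x x′ y} → Leaf x y → Leaf x′ y → x ≢ x′ → 𝒯 T
  two-leaves {x} {x′} {y} leaf leaf′ x≢x′ = reduce pendant (O₂ u (restrict S , γτ′ , u∈S′)) γτ′
    where
    pendant : Pendant T 1 (List.lookup (x′ ∷ [])) zero y
    pendant = pendant-path T ([] ∷ []) [-] (≢-sym (≁-self (proj₁ leaf′)) ∷ []) (~-sym (proj₁ leaf′))
      λ { zero e → inj₂ (proj₂ leaf′ e , refl) }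
    open Removal T pendant
    x₀ : ∃[ i ] x ≡ ι i
    x₀ = outside-ι λ { zero → x≢x′ }
    leafₓ : EndVertex T′ (proj₁ x₀) u
    leafₓ = endVertex′ (subst₂ Leaf (proj₂ x₀) p≡ιu leaf)
    y∈S = support-dominates T dominates leaf
    u∈S′ = ∈-restrict⁺ (subst (_∈ S) p≡ιu y∈S)
    none : Subset 1
    none = outside ∷ []
    γτ′ : γₜ-τ-Set T′ (restrict S)
    γτ′ = let w , w∈S , y~w = dominates y in
      restrict-γₜ-τ γτ w∈S y~w (λ { zero refl → leaf∉S leaf′ w∈S }) z≤n
        (λ X vc → let X₁ , vc₁ , u∈X₁ , X₁≤ = cover-with-support T′ leafₓ vc in
          glue X₁ none
          , glue-cover vc₁ (from-yes (vertexCover? (P 1) none)) (inj₁ u∈X₁)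
          , ℕ.≤-trans (ℕ.≤-reflexive (∣glue∣ X₁ none)) (ℕ.+-monoˡ-≤ 0 X₁≤))
        (λ D td → glue D none
          , glue-dominates D none (inj₁ ∘ td) (λ { zero → inj₂ (refl , support-dominates T′ td leafₓ) })
          , ℕ.≤-reflexive (∣glue∣ D none))

  -- Undoes `O₃` by removing `d` and `e`, at cost one for `d`. The second support `z` next to `c`
  -- keeps `c` dominated and prevents it from being quasi-isolated.
  pendant-edge : ∀ {c d e y z} → c ∈ S →
                 Leaf e d → d ~ c → (∀ {x} → d ~ x → x ≡ c ⊎ x ≡ e) →
                 Leaf y z → z ~ c → z ≢ d →
                 (∃[ x ] Leaf x c) ⊎ (∀ {x} → z ~ x → x ≡ c ⊎ x ≡ y) → 𝒯 T
  pendant-edge {c} {d} {e} {y} {z} c∈S leafₑ d~c Nd leafᵧ z~c z≢d alt =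
    reduce pendant (O₃ u (restrict S , γτ′ , ∈-restrict⁺ (subst (_∈ S) p≡ιu c∈S)) ¬quasi) γτ′
    where
    c≢e : c ≢ e
    c≢e refl = z≢d (proj₂ leafₑ (~-sym z~c))
    y≢c : y ≢ c
    y≢c refl = z≢d (sym (proj₂ leafᵧ (~-sym d~c)))
    pendant : Pendant T 2 (List.lookup (d ∷ e ∷ [])) zero c
    pendant = pendant-path T
      ((≢-sym (≁-self (proj₁ leafₑ)) ∷ []) ∷ [] ∷ []) (~-sym (proj₁ leafₑ) ∷ [-])
      (≢-sym (≁-self d~c) ∷ c≢e ∷ []) (~-sym d~c)
      λ where
        zero d~x → [ (λ eq → inj₂ (eq , refl)) , (λ eq → inj₁ (suc zero , eq , inj₁ refl)) ]′ (Nd d~x)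
        (suc zero) e~x → inj₁ (zero , proj₂ leafₑ e~x , inj₂ refl)
    open Removal T pendant
    d∈S = support-dominates T dominates leafₑ
    z∉ : ∀ j → z ≢ List.lookup (d ∷ e ∷ []) j
    z∉ zero       = z≢d
    z∉ (suc zero) refl = ≁-self d~c (sym (proj₂ leafₑ z~c))
    z₀ = outside-ι z∉
    y₀ : ∃[ i ] y ≡ ι i
    y₀ = outside-ι λ where
      zero refl       → ≁-self z~c (sym (proj₂ leafᵧ d~c))
      (suc zero) refl → z≢d (sym (proj₂ leafᵧ (proj₁ leafₑ)))
    leafᵧ′ : EndVertex T′ (proj₁ y₀) (proj₁ z₀)
    leafᵧ′ = endVertex′ (subst₂ Leaf (proj₂ y₀) (proj₂ z₀) leafᵧ)
    z~c′ : Graph._~_ T′ (proj₁ z₀) u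
    z~c′ = subst₂ _~_ (proj₂ z₀) p≡ιu z~c
    x₀ : ∀ {x} → Leaf x c → ∃[ i ] x ≡ ι i
    x₀ leafₓ = outside-ι λ where
      zero refl       → c≢e (sym (proj₂ leafₓ (~-sym (proj₁ leafₑ))))
      (suc zero) refl → ≁-self d~c (proj₂ leafₓ (proj₁ leafₑ))
    -- The vertex `d` will need `c` as its dominator. This is where `alt` enters: a leaf at `c`
    -- forces `c` into `D`, and a support `z` of degree two permits an exchange.
    dominating-with-u : ∀ D → TotallyDominates T′ D →
                        ∃[ D₁ ] (TotallyDominates T′ D₁ × u ∈ D₁ × ∣ D₁ ∣ ≤ ∣ D ∣)
    dominating-with-u D td = case alt of λ where
      (inj₁ (x , leafₓ)) →
        D , td , support-dominates T′ td (endVertex′ (subst₂ Leaf (proj₂ (x₀ leafₓ)) p≡ιu leafₓ)) , ℕ.≤-refl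
      (inj₂ Nz) → dominating-with-end T′ leafᵧ′ z~c′
        (λ {a} e → Sum.map (λ eq → ι-injective _ _ (trans eq p≡ιu)) (λ eq → ι-injective _ _ (trans eq (proj₂ y₀)))
                 (Nz (subst (_~ ι a) (sym (proj₂ z₀)) e))) td
    first : Subset 2
    first = inside ∷ outside ∷ []
    γτ′ : γₜ-τ-Set T′ (restrict S)
    γτ′ = restrict-γₜ-τ γτ (support-dominates T dominates leafᵧ) (~-sym z~c) z∉
      (1≤∣∣ (∈-removed⁺ {j = zero} d∈S))
      (λ X vc → glue X first
        , glue-cover vc (from-yes (vertexCover? (P 2) first)) (inj₂ here)
        , ℕ.≤-reflexive (∣glue∣ X first))
      (λ D td → let D₁ , td₁ , u∈D₁ , D₁≤ = dominating-with-u D td in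
        glue D₁ first
        , glue-dominates D₁ first (inj₁ ∘ td₁) (λ where
            zero       → inj₂ (refl , u∈D₁)
            (suc zero) → inj₁ (zero , here , inj₂ refl))
        , ℕ.≤-trans (ℕ.≤-reflexive (∣glue∣ D₁ first)) (ℕ.+-monoˡ-≤ 1 D₁≤))
    ¬quasi : ¬ QuasiIsolated T′ u
    -- As support of `y`, the vertex `z` is in `D`, so the `a` to which `u` is private must be `z`.
    -- But `y` is private to `z` as well, hence would equal `u`.
    ¬quasi (D , (td , _) , a , a∈D , sub , sup) =
      y≢c (sym (trans p≡ιu (trans (cong ι u≡y₀) (sym (proj₂ y₀)))))
      where
      td′ = ⇒totallyDominates T′ td
      z∈D = support-dominates T′ td′ leafᵧ′
      z≡a : proj₁ z₀ ≡ a
      z≡a = proj₂ (pn⁻ T′ (sup refl)) z∈D (Graph.~-sym T′ z~c′)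
      u≡y₀ : u ≡ proj₁ y₀
      u≡y₀ = sub (subst (λ b → pn T′ b D (proj₁ y₀)) z≡a
        (pn⁺ T′ z∈D (proj₁ leafᵧ′) (λ _ → proj₂ leafᵧ′)))

  -- Undoes `O₄` by removing `l`, `c`, `d`, `e`; the set `middle` consists of `c` and `d`, and `w`
  -- keeps `p` dominated.
  pendant-P₄-by-support : ∀ {c d e l p w} → c ∈ S →
                          Leaf e d → d ~ c → (∀ {x} → d ~ x → x ≡ c ⊎ x ≡ e) →
                          Leaf l c → c ~ p → p ≢ d → p ≢ l →
                          (∀ {x} → c ~ x → x ≡ l ⊎ x ≡ d ⊎ x ≡ p) →
                          w ∈ S → p ~ w → w ≢ c → 𝒯 T
  pendant-P₄-by-support {c} {d} {e} {l} {p} {w} c∈S leafₑ d~c Nd leafₗ c~p p≢d p≢l Nc w∈S p~w w≢c =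
    reduce pendant (O₄ u (suc zero) ¬quasi (zero , refl , inj₂ refl)) γτ′
    where
    c≢e : c ≢ e
    c≢e refl = p≢d (proj₂ leafₑ c~p)
    l≢d : l ≢ d
    l≢d refl = c≢e (sym (proj₂ leafₗ (~-sym (proj₁ leafₑ))))
    l≢e : l ≢ e
    l≢e refl = ≁-self d~c (proj₂ leafₗ (proj₁ leafₑ))
    p≢e : p ≢ e
    p≢e refl = ≁-self d~c (sym (proj₂ leafₑ (~-sym c~p)))
    path = l ∷ c ∷ d ∷ e ∷ []
    pendant : Pendant T 4 (List.lookup path) (suc zero) p
    pendant = pendant-path T
      ( (≁-self (proj₁ leafₗ) ∷ l≢d ∷ l≢e ∷ []) ∷ (≢-sym (≁-self d~c) ∷ c≢e ∷ [])
      ∷ (≢-sym (≁-self (proj₁ leafₑ)) ∷ []) ∷ [] ∷ [])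
      (proj₁ leafₗ ∷ ~-sym d~c ∷ ~-sym (proj₁ leafₑ) ∷ [-])
      (p≢l ∷ ≢-sym (≁-self c~p) ∷ p≢d ∷ p≢e ∷ []) (~-sym c~p)
      λ where
        zero l~x → inj₁ (suc zero , proj₂ leafₗ l~x , inj₁ refl)
        (suc zero) c~x → case Nc c~x of λ where
          (inj₁ eq)        → inj₁ (zero , eq , inj₂ refl)
          (inj₂ (inj₁ eq)) → inj₁ (suc (suc zero) , eq , inj₁ refl)
          (inj₂ (inj₂ eq)) → inj₂ (eq , refl)
        (suc (suc zero)) d~x → case Nd d~x of λ where
          (inj₁ eq) → inj₁ (suc zero , eq , inj₂ refl)
          (inj₂ eq) → inj₁ (suc (suc (suc zero)) , eq , inj₁ refl)
        (suc (suc (suc zero))) e~x → inj₁ (suc (suc zero) , proj₂ leafₑ e~x , inj₂ refl)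
    open Removal T pendant
    w∉ : ∀ j → w ≢ List.lookup path j
    w∉ zero                   refl = leaf∉S leafₗ w∈S
    w∉ (suc zero)                  = w≢c
    w∉ (suc (suc zero))       refl = [ ≢-sym (≁-self c~p) , p≢e ]′ (Nd (~-sym p~w))
    w∉ (suc (suc (suc zero))) refl = leaf∉S leafₑ w∈S
    2≤removed : 2 ≤ ∣ removed S ∣
    2≤removed = 2≤∣∣ (∈-removed⁺ {j = suc zero} c∈S)
      (∈-removed⁺ {j = suc (suc zero)} (support-dominates T dominates leafₑ)) λ ()
    γτ′ : γₜ-τ-Set T′ (restrict S)
    γτ′ = restrict-γₜ-τ γτ w∈S p~w w∉ 2≤removed
      (λ X vc → glue X middle
        , glue-cover vc middle-covers (inj₂ (there here))
        , ℕ.≤-reflexive (∣glue∣ X middle))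
      (λ D td → glue D middle
        , glue-dominates D middle (inj₁ ∘ td) (inj₁ ∘ middle-dominates)
        , ℕ.≤-reflexive (∣glue∣ D middle))
    ¬quasi : ¬ QuasiIsolated T′ u
    -- If `u` were the only vertex private to `a`, then `D - a` would miss only `u`, which `c`
    -- dominates in `T`. Adding `c` and `d` would then give a total dominating set smaller than `S`.
    ¬quasi (D , (td , _ , minD) , a , a∈D , sub , sup) =
      ℕ.<⇒≱ small (dominates-minimal (glue (D - a) middle)
        (glue-dominates (D - a) middle dom (inj₁ ∘ middle-dominates)))
      where
      dom : ∀ i → (∃[ i′ ] (i′ ∈ D - a × Graph._~_ T′ i i′)) ⊎ (i ≡ u × suc zero ∈ middle)
      dom i with Fin.any? (λ b → (b ∈? D) ×-dec (Graph._~?_ T′ i b) ×-dec ¬? (b Fin.≟ a))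
      ... | yes (b , b∈D , i~b , b≢a) = inj₁ (b , x∈p∧x≢y⇒x∈p-y b∈D b≢a , i~b)
      ... | no none = inj₂ (sym (sub (pn⁺ T′ a∈D i~a only)) , there here)
        where
        only : ∀ {b} → b ∈ D → Graph._~_ T′ i b → b ≡ a
        only {b} b∈D i~b = decidable-stable (b Fin.≟ a) λ b≢a → none (b , b∈D , i~b , b≢a)
        i~a : Graph._~_ T′ i a
        i~a = let b , b∈D , i~b = ⇒totallyDominates T′ td i in subst (Graph._~_ T′ i) (only b∈D i~b) i~b
      open ℕ.≤-Reasoning
      small : ∣ glue (D - a) middle ∣ < ∣ S ∣
      small = begin-strict
        ∣ glue (D - a) middle ∣               ≡⟨ ∣glue∣ (D - a) middle ⟩
        ∣ D - a ∣ + 2                         <⟨ ℕ.+-monoˡ-< 2 (x∈p⇒∣p-x∣<∣p∣ a∈D) ⟩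
        ∣ D ∣ + 2                             ≤⟨ ℕ.+-mono-≤ (minD (restrict S) (proj₁ (proj₁ γτ′))) 2≤removed ⟩
        ∣ restrict S ∣ + ∣ removed S ∣        ≡⟨ ∣restrict∣ S ⟨
        ∣ S ∣                                 ∎

  -- Undoes `O₁` by removing `p`, `c`, `d`, `e`. As `p` is outside `S`, the edge to `q` puts `q` in
  -- `S`.
  pendant-P₄-by-leaf : ∀ {c d e p q} → c ∈ S → p ∉ S →
                       Leaf e d → d ~ c → (∀ {x} → d ~ x → x ≡ c ⊎ x ≡ e) →
                       c ~ p → p ≢ d → (∀ {x} → c ~ x → x ≡ d ⊎ x ≡ p) →
                       p ~ q → q ≢ c → (∀ {x} → p ~ x → x ≡ c ⊎ x ≡ q) → 𝒯 T
  pendant-P₄-by-leaf {c} {d} {e} {p} {q} c∈S p∉S leafₑ d~c Nd c~p p≢d Nc p~q q≢c Np =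
    reduce pendant (O₁ u zero (restrict S , γτ′ , ∈-restrict⁺ (subst (_∈ S) p≡ιu q∈S)) refl) γτ′
    where
    q∈S = nbr∈S p∉S p~q
    c≢e : c ≢ e
    c≢e refl = p≢d (proj₂ leafₑ c~p)
    p≢e : p ≢ e
    p≢e refl = ≁-self d~c (sym (proj₂ leafₑ (~-sym c~p)))
    p≁d : ¬ (d ~ p)
    p≁d d~p = [ ≢-sym (≁-self c~p) , p≢e ]′ (Nd d~p)
    p≁e : ¬ (e ~ p)
    p≁e e~p = p≢d (proj₂ leafₑ e~p)
    path = p ∷ c ∷ d ∷ e ∷ []
    pendant : Pendant T 4 (List.lookup path) zero q
    pendant = pendant-path T
      ( (≢-sym (≁-self c~p) ∷ p≢d ∷ p≢e ∷ []) ∷ (≢-sym (≁-self d~c) ∷ c≢e ∷ [])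
      ∷ (≢-sym (≁-self (proj₁ leafₑ)) ∷ []) ∷ [] ∷ [])
      (~-sym c~p ∷ ~-sym d~c ∷ ~-sym (proj₁ leafₑ) ∷ [-])
      (≢-sym (≁-self p~q) ∷ q≢c ∷ (λ { refl → p≁d (~-sym p~q) }) ∷ (λ { refl → p≁e (~-sym p~q) }) ∷ [])
      (~-sym p~q)
      λ where
        zero p~x → case Np p~x of λ where
          (inj₁ eq) → inj₁ (suc zero , eq , inj₁ refl)
          (inj₂ eq) → inj₂ (eq , refl)
        (suc zero) c~x → case Nc c~x of λ where
          (inj₁ eq) → inj₁ (suc (suc zero) , eq , inj₁ refl)
          (inj₂ eq) → inj₁ (zero , eq , inj₂ refl)
        (suc (suc zero)) d~x → case Nd d~x of λ where
          (inj₁ eq) → inj₁ (suc zero , eq , inj₂ refl)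
          (inj₂ eq) → inj₁ (suc (suc (suc zero)) , eq , inj₁ refl)
        (suc (suc (suc zero))) e~x → inj₁ (suc (suc zero) , proj₂ leafₑ e~x , inj₂ refl)
    open Removal T pendant
    γτ′ : γₜ-τ-Set T′ (restrict S)
    γτ′ = let w , w∈S , q~w = dominates q in
      restrict-γₜ-τ γτ w∈S q~w
        (λ where
          zero refl                   → p∉S w∈S
          (suc zero) refl             → [ (λ { refl → p≁d (~-sym p~q) }) , ≢-sym (≁-self p~q) ]′ (Nc (~-sym q~w))
          (suc (suc zero)) refl       → [ q≢c , (λ { refl → p≁e (~-sym p~q) }) ]′ (Nd (~-sym q~w))
          (suc (suc (suc zero))) refl → leaf∉S leafₑ w∈S)
        (2≤∣∣ (∈-removed⁺ {j = suc zero} c∈S)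
          (∈-removed⁺ {j = suc (suc zero)} (support-dominates T dominates leafₑ)) λ ())
        (λ X vc → glue X alternate
          , glue-cover vc (from-yes (vertexCover? (P 4) alternate)) (inj₂ here)
          , ℕ.≤-reflexive (∣glue∣ X alternate))
        (λ D td → glue D middle
          , glue-dominates D middle (inj₁ ∘ td) (inj₁ ∘ middle-dominates)
          , ℕ.≤-reflexive (∣glue∣ D middle))
      where
      -- For covers `middle` could leave the bridge uncovered; `p` and `d` cover both the path and
      -- the bridge at the same cost.
      alternate : Subset 4
      alternate = inside ∷ outside ∷ inside ∷ outside ∷ []

  whole-P₄ : ∀ {c d e p} → Leaf e d → d ~ c → (∀ {x} → d ~ x → x ≡ c ⊎ x ≡ e) →
             Leaf p c → p ≢ d → (∀ {x} → c ~ x → x ≡ d ⊎ x ≡ p) → 𝒯 T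
  whole-P₄ {c} {d} {e} {p} leafₑ d~c Nd leafₚ p≢d Nc = 𝒯.iso base
    (spanning-path T connected
      ( (≁-self (proj₁ leafₚ) ∷ p≢d ∷ p≢e ∷ []) ∷ (≢-sym (≁-self d~c) ∷ c≢e ∷ [])
      ∷ (≢-sym (≁-self (proj₁ leafₑ)) ∷ []) ∷ [] ∷ [])
      (proj₁ leafₚ ∷ ~-sym d~c ∷ ~-sym (proj₁ leafₑ) ∷ [-])
      λ where
        zero p~x → suc zero , proj₂ leafₚ p~x , inj₁ refl
        (suc zero) c~x → case Nc c~x of λ where
          (inj₁ eq) → suc (suc zero) , eq , inj₁ refl
          (inj₂ eq) → zero , eq , inj₂ refl
        (suc (suc zero)) d~x → case Nd d~x of λ where
          (inj₁ eq) → suc zero , eq , inj₂ refl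
          (inj₂ eq) → suc (suc (suc zero)) , eq , inj₁ refl
        (suc (suc (suc zero))) e~x → suc (suc zero) , proj₂ leafₑ e~x , inj₂ refl)
    where
    c≢e : c ≢ e
    c≢e refl = p≢d (proj₂ leafₑ (~-sym (proj₁ leafₚ)))
    p≢e : p ≢ e
    p≢e refl = ≁-self d~c (sym (proj₂ leafₑ (proj₁ leafₚ)))

  -- Branches of height three; a `Chain` is a bare path `c`, `d`, `e` below `p`

  record Chain (p c : Fin n) : Set where
    field
      {d e} : Fin n
      leaf  : Leaf e d
      d~c   : d ~ c
      Nd    : ∀ {x} → d ~ x → x ≡ c ⊎ x ≡ e
      Nc    : ∀ {x} → c ~ x → x ≡ d ⊎ x ≡ p

  -- By the height bound all children of `d` are leaves. `outer-nbr` yields one, since `c` is in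
  -- `S`, and a second one is removed by `two-leaves`.
  sole-leaf : ∀ {c d} → c ∈ S → d ∈ S → d ~ c → Height≤ T 1 c d →
              𝒯 T ⊎ (∃[ e ] (Leaf e d × (∀ {x} → d ~ x → x ≡ c ⊎ x ≡ e)))
  sole-leaf {c} {d} c∈S d∈S d~c H
    with e , e∉S , d~e ← outer-nbr d∈S
    with Fin.any? (λ x → (d ~? x) ×-dec ¬? (x Fin.≟ c) ×-dec ¬? (x Fin.≟ e))
  ... | yes (x , d~x , x≢c , x≢e) = inj₁ (two-leaves (leaf d~x x≢c) (leaf d~e (λ { refl → e∉S c∈S })) x≢e)
    where
    leaf : ∀ {x} → d ~ x → x ≢ c → Leaf x d
    leaf d~x x≢c = ~-sym d~x , λ {z} → H _ d~x x≢c z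
  ... | no none = inj₂ (e , (~-sym d~e , λ {z} → H _ d~e (λ { refl → e∉S c∈S }) z) , Nd)
    where
    Nd : ∀ {x} → d ~ x → x ≡ c ⊎ x ≡ e
    Nd {x} d~x with x Fin.≟ c | x Fin.≟ e
    ... | yes eq | _      = inj₁ eq
    ... | no _   | yes eq = inj₂ eq
    ... | no x≢c | no x≢e = contradiction (x , d~x , x≢c , x≢e) none

  -- A child of `x` would be in `S` to cover its edge, yet be a leaf by the height bound.
  outer-child-leaf : ∀ {p c x} → Height≤ T 2 p c → c ~ x → x ≢ p → x ∉ S → Leaf x c
  outer-child-leaf {p} {c} {x} H c~x x≢p x∉S = ~-sym c~x , λ {y} x~y →
    decidable-stable (y Fin.≟ c) λ y≢c →
      leaf∉S (~-sym x~y , λ {z} → H x c~x x≢p y x~y y≢c z) (nbr∈S x∉S x~y)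

  module _ {p c d} (p~c : p ~ c) (c∈S : c ∈ S) (d∈S : d ∈ S) (c~d : c ~ d) (d≢p : d ≢ p)
           (H : Height≤ T 2 p c) where

    -- A second leaf below `c` is removed at once. Otherwise the pendant P₄ goes if `p` has another
    -- neighbour in `S`; if `c` is the only one, the cases `p` outside and inside `S` remain.
    with-leaf : ∀ {e l} → Leaf e d → (∀ {x} → d ~ x → x ≡ c ⊎ x ≡ e) →
                (∀ {x} → c ~ x → x ∈ S → x ≡ d ⊎ x ≡ p) →
                Leaf l c → l ≢ p → 𝒯 T
    with-leaf {e} {l} leafₑ Nd inner leafₗ l≢p
      with Fin.any? (λ x → (c ~? x) ×-dec ¬? (x Fin.≟ p) ×-dec ¬? (x ∈? S) ×-dec ¬? (x Fin.≟ l))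
    ... | yes (x , c~x , x≢p , x∉S , x≢l) = two-leaves (outer-child-leaf H c~x x≢p x∉S) leafₗ x≢l
    ... | no none with Fin.any? (λ w → (w ∈? S) ×-dec (p ~? w) ×-dec ¬? (w Fin.≟ c))
    ...   | yes (w , w∈S , p~w , w≢c) =
      pendant-P₄-by-support c∈S leafₑ (~-sym c~d) Nd leafₗ (~-sym p~c) (≢-sym d≢p) (≢-sym l≢p) Nc w∈S p~w w≢c
      where
      Nc : ∀ {x} → c ~ x → x ≡ l ⊎ x ≡ d ⊎ x ≡ p
      Nc {x} c~x with x ∈? S | x Fin.≟ l | x Fin.≟ p
      ... | yes x∈S | _      | _      = inj₂ (inner c~x x∈S)
      ... | no _    | yes eq | _      = inj₁ eq
      ... | no _    | no _   | yes eq = inj₂ (inj₂ eq)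
      ... | no x∉S  | no x≢l | no x≢p = contradiction (x , c~x , x≢p , x∉S , x≢l) none
    ...   | no alone with p ∈? S
    -- All neighbours of `p` are in `S`, hence equal to `c`, so `p` is a second leaf at `c`.
    ...     | no p∉S = two-leaves leafₗ (p~c , λ p~x → only p~x (nbr∈S p∉S p~x)) l≢p
      where
      only : ∀ {x} → p ~ x → x ∈ S → x ≡ c
      only {x} p~x x∈S = decidable-stable (x Fin.≟ c) λ x≢c → alone (x , x∈S , p~x , x≢c)
    -- Outside `S`, the private neighbour `y` is a leaf at `p`, and `p` serves as the second support
    -- next to `c`. Inside `S`, it would be `c`, which also has the neighbour `d` in `S`.
    ...     | yes p∈S with y , y~p , private′ ← private-nbr p∈S with y ∈? S
    ...       | no y∉S =
      pendant-edge c∈S leafₑ (~-sym c~d) Nd (y~p , λ y~x → private′ (nbr∈S y∉S y~x) y~x)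
        p~c (≢-sym d≢p) (inj₁ (l , leafₗ))
    ...       | yes y∈S with refl ← decidable-stable (y Fin.≟ c) (λ y≢c → alone (y , y∈S , ~-sym y~p , y≢c)) =
      contradiction (private′ d∈S c~d) d≢p

    -- A second child of `c` in `S` is a support and leads to `pendant-edge`; a child outside `S` is
    -- a leaf and leads to `with-leaf`. With neither, only `p` can be the neighbour of `c` outside
    -- `S`.
    branch : 𝒯 T ⊎ (p ∉ S × Chain p c)
    branch with sole-leaf c∈S d∈S (~-sym c~d) (H d c~d d≢p)
    ... | inj₁ done = inj₁ done
    ... | inj₂ (e , leafₑ , Nd)
      with Fin.any? (λ x → (c ~? x) ×-dec (x ∈? S) ×-dec ¬? (x Fin.≟ d) ×-dec ¬? (x Fin.≟ p))
    ...   | yes (z , c~z , z∈S , z≢d , z≢p) with sole-leaf c∈S z∈S (~-sym c~z) (H z c~z z≢p)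
    ...     | inj₁ done = inj₁ done
    ...     | inj₂ (y , leafᵧ , Nz) =
      inj₁ (pendant-edge c∈S leafₑ (~-sym c~d) Nd leafᵧ (~-sym c~z) z≢d (inj₂ Nz))
    branch | inj₂ (e , leafₑ , Nd) | no alone
      with Fin.any? (λ l → (c ~? l) ×-dec ¬? (l Fin.≟ p) ×-dec ¬? (l ∈? S))
    ...   | yes (l , c~l , l≢p , l∉S) =
      inj₁ (with-leaf leafₑ Nd inner (outer-child-leaf H c~l l≢p l∉S) l≢p)
      where
      inner : ∀ {x} → c ~ x → x ∈ S → x ≡ d ⊎ x ≡ p
      inner {x} c~x x∈S with x Fin.≟ d | x Fin.≟ p
      ... | yes eq | _      = inj₁ eq
      ... | no _   | yes eq = inj₂ eq
      ... | no x≢d | no x≢p = contradiction (x , c~x , x∈S , x≢d , x≢p) alone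
    ...   | no leafless = inj₂ (p∉S , record { leaf = leafₑ ; d~c = ~-sym c~d ; Nd = Nd ; Nc = Nc })
      where
      Nc : ∀ {x} → c ~ x → x ≡ d ⊎ x ≡ p
      Nc {x} c~x with x Fin.≟ d | x Fin.≟ p | x ∈? S
      ... | yes eq | _      | _       = inj₁ eq
      ... | no _   | yes eq | _       = inj₂ eq
      ... | no x≢d | no x≢p | yes x∈S = contradiction (x , c~x , x∈S , x≢d , x≢p) alone
      ... | no _   | no x≢p | no x∉S  = contradiction (x , c~x , x≢p , x∉S) leafless
      p∉S : p ∉ S
      p∉S = let y , y∉S , c~y = outer-nbr c∈S in
        [ (λ { refl → contradiction d∈S y∉S }) , (λ { refl → y∉S }) ]′ (Nc c~y)

  -- Otherwise exchanging c and c′ for p would give a smaller cover.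
  chains-coincide : ∀ {p c c′} → p ~ c → p ~ c′ → c ∈ S → c′ ∈ S → Chain p c → Chain p c′ → c ≡ c′
  chains-coincide {p} {c} {c′} p~c p~c′ c∈S c′∈S chain chain′ = decidable-stable (c Fin.≟ c′) λ c≢c′ →
    contradiction (covers-minimal X (vc c≢c′)) (ℕ.<⇒≱ (begin-strict
      ∣ (S - c) [ c′ ↦ p ] ∣  ≤⟨ ∣[↦]∣≤ (x∈p∧x≢y⇒x∈p-y c′∈S (≢-sym c≢c′)) ⟩
      ∣ S - c ∣               <⟨ x∈p⇒∣p-x∣<∣p∣ c∈S ⟩
      ∣ S ∣                   ∎))
    where
    open ℕ.≤-Reasoning
    X = (S - c) [ c′ ↦ p ]
    kept : ∀ {x} → x ∈ S → x ≢ c → x ≢ c′ → x ∈ X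
    kept x∈S x≢c x≢c′ = old∈[↦] (x∈p∧x≢y⇒x∈p-y x∈S x≢c) x≢c′
    -- If `d` were `b`, then `p` would be adjacent to `d`, hence be `a` or the leaf `e`. The former
    -- is no neighbour of itself, and the latter has no two distinct neighbours.
    apart : ∀ {a b} → p ~ a → p ~ b → a ≢ b → (ch : Chain p a) → Chain.d ch ≢ b
    apart p~a p~b a≢b ch refl =
      [ ≁-self p~a , (λ { refl → a≢b (proj₂ (Chain.leaf ch) p~a) }) ]′ (Chain.Nd ch (~-sym p~b))
    module _ (c≢c′ : c ≢ c′) where
      near : ∀ {x} → c ~ x → x ∈ X
      near c~x with Chain.Nc chain c~x
      ... | inj₁ refl = kept (support-dominates T dominates (Chain.leaf chain))
                          (≁-self (Chain.d~c chain)) (apart p~c p~c′ c≢c′ chain)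
      ... | inj₂ refl = new∈[↦] (S - c)
      near′ : ∀ {x} → c′ ~ x → x ∈ X
      near′ c′~x with Chain.Nc chain′ c′~x
      ... | inj₁ refl = kept (support-dominates T dominates (Chain.leaf chain′))
                          (apart p~c′ p~c (≢-sym c≢c′) chain′) (≁-self (Chain.d~c chain′))
      ... | inj₂ refl = new∈[↦] (S - c)
      half : ∀ {a b} → a ~ b → a ∈ S → a ∈ X ⊎ b ∈ X
      half {a} a~b a∈S with a Fin.≟ c | a Fin.≟ c′
      ... | yes refl | _        = inj₂ (near a~b)
      ... | no _     | yes refl = inj₂ (near′ a~b)
      ... | no a≢c   | no a≢c′  = inj₁ (kept a∈S a≢c a≢c′)
      vc : IsVertexCover T X
      vc a b a~b = [ half a~b , Sum.swap ∘ half (~-sym a~b) ]′ (covers a b a~b)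

  -- If `p` is outside `S`, any other child of `p` is in `S`, and so is its dominator, which
  -- therefore lies below it. Thus `branch` applies to that child too, and two chains are
  -- impossible.
  top : ∀ {q p c d} → p ~ c → c ≢ q → c ∈ S → d ∈ S → c ~ d → d ≢ p → Height≤ T 3 q p → 𝒯 T
  top {q} {p} {c} {d} p~c c≢q c∈S d∈S c~d d≢p H
    with branch p~c c∈S d∈S c~d d≢p (H c p~c c≢q)
  ... | inj₁ done = done
  ... | inj₂ (p∉S , chain)
    with Fin.any? (λ c′ → (p ~? c′) ×-dec ¬? (c′ Fin.≟ c) ×-dec ¬? (c′ Fin.≟ q))
  ...   | yes (c′ , p~c′ , c′≢c , c′≢q) with d′ , d′∈S , c′~d′ ← dominates c′
    with branch p~c′ (nbr∈S p∉S p~c′) d′∈S c′~d′ (λ { refl → p∉S d′∈S }) (H c′ p~c′ c′≢q)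
  ...     | inj₁ done         = done
  ...     | inj₂ (_ , chain′) =
    contradiction (chains-coincide p~c p~c′ c∈S (nbr∈S p∉S p~c′) chain chain′) (≢-sym c′≢c)
  top {q} {p} {c} p~c c≢q c∈S _ _ _ H | inj₂ (p∉S , chain) | no alone = conclude
    where
    open Chain chain
    Np : ∀ {x} → p ~ x → x ≡ c ⊎ x ≡ q
    Np {x} p~x with x Fin.≟ c | x Fin.≟ q
    ... | yes eq | _      = inj₁ eq
    ... | no _   | yes eq = inj₂ eq
    ... | no x≢c | no x≢q = contradiction (x , p~x , x≢c , x≢q) alone
    p≢d : p ≢ Chain.d chain
    p≢d refl = p∉S (support-dominates T dominates leaf)
    conclude : 𝒯 T
    -- When `p` is the root, `q` is `p` itself and not a neighbour; the path is then the whole tree.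
    conclude with p ~? q
    ... | yes p~q = pendant-P₄-by-leaf c∈S p∉S leaf d~c Nd (~-sym p~c) p≢d Nc p~q (≢-sym c≢q) Np
    ... | no  p≁q = whole-P₄ leaf d~c Nd
      (p~c , λ p~x → [ (λ eq → eq) , (λ { refl → contradiction p~x p≁q }) ]′ (Np p~x)) p≢d Nc

  -- The height yields a path `p`, `c`, `d`, `e`. The leaf `e` puts `d` in `S`; the other children
  -- of `d` are leaves too, so only `c` can dominate `d` from within `S`.
  from-branch : ∀ {q p} → Height≤ T 3 q p → ¬ Height≤ T 2 q p → 𝒯 T
  from-branch {q} {p} H tall
    with c , p~c , c≢q , tallᶜ ← tall-child T 1 tall
    with d , c~d , d≢p , tallᵈ ← tall-child T 0 tallᶜ
    with e , d~e , e≢c ← tall-child₀ T tallᵈ = top p~c c≢q c∈S d∈S c~d d≢p H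
    where
    leaf : ∀ {x} → d ~ x → x ≢ c → Leaf x d
    leaf d~x x≢c = ~-sym d~x , λ {z} → H c p~c c≢q d c~d d≢p _ d~x x≢c z
    d∈S : d ∈ S
    d∈S = support-dominates T dominates (leaf d~e e≢c)
    c∈S : c ∈ S
    c∈S = let x , x∈S , d~x = dominates d in
      decidable-stable (c ∈? S) λ c∉S → leaf∉S (leaf d~x (λ { refl → c∉S x∈S })) x∈S

  -- From `b` outside `S`, go to a dominator, to its dominator, and to a neighbour outside `S`.
  -- Membership in `S` shows that this walk of length three never turns back.
  tall-from-outside : ∀ {b} → b ∉ S → ¬ Height≤ T 2 b b
  tall-from-outside {b} b∉S H
    with c , c∈S , b~c ← dominates b
    with d , d∈S , c~d ← dominates c
    with e , e∉S , d~e ← outer-nbr d∈S =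
    e∉S (subst (_∈ S) (sym (H c b~c (≢-sym (≁-self b~c)) d c~d (λ { refl → b∉S d∈S }) e d~e)) c∈S)

  outside-vertex : Fin n → ∃[ b ] b ∉ S
  outside-vertex x with x ∈? S
  ... | yes x∈S = let y , y∉S , _ = outer-nbr x∈S in y , y∉S
  ... | no  x∉S = x , x∉S

  member : Fin n → 𝒯 T
  member x =
    let b , b∉S = outside-vertex x
        h , H = bounded
        _ , _ , H₃ , tall = branch-of-height T 2 h (H b) (tall-from-outside b∉S)
    in from-branch H₃ tall

-- Induction on the number of vertices

in-𝒯 : ∀ {n} → Acc _<_ n → (T : Graph n) → Graph.Connected T → Bounded T → Fin n →
       ∃ (γₜ-τ-Set T) → 𝒯 T
in-𝒯 (acc rec) T connected bounded x (S , γτ) =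
  Reduction.member T connected bounded (λ T′ m<n → in-𝒯 (rec m<n) T′) S γτ x

theorem10 : (n : ℕ) (T : Graph n) → Graph.IsTree T → ∃ (γₜ-τ-Set T) → 𝒯 T
theorem10 n T tree = in-𝒯 (<-wellFounded n) T connected (suc n , acyclic⇒bounded T acyclic) (vertex nonEmpty)
  where
  open Graph.IsTree tree
  vertex : ∀ {n} → ℕ.NonZero n → Fin n
  vertex {suc _} _ = zero
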